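{- For an integer $k$, let $ex_2(SC_k^3,n)$ denote the maximum number of edges of an $n$-vertex geometric $3$-hypergraph in the plane that does not contain $k$ strongly crossing edges. Then for every fixed integer $k\ge 4$, $ex_2(SC_k^3,n)\le O\left(n^{3-\frac1k}\right)$; that is, for every integer $k\ge 4$ there is a constant $C_k$ depending only on $k$ such that $ex_2(SC_k^3,n)\le C_k\,n^{3-\frac1k}$ for all $n\ge 1$.
   Context: A geometric $3$-hypergraph in the plane is a pair $H=(V,E)$, where $V$ is a finite set of points in general position in $\mathbb{R}^2$ (no three on a line) and $E$ is a set of closed triangles, each being the convex hull of some $3$-element subset of $V$ (its vertices). $H$ is $n$-vertex if $|V|=n$. $H$ contains $k$ strongly crossing edges if there are $k$ edges in $E$ that are pairwise vertex disjoint (no two share a vertex) and such that all $k$ closed triangles have a common point. -}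

module Defs where

open import Data.Nat.Base as ℕ using (ℕ; zero; suc)
import Data.Nat.Properties as ℕₚ
open import Data.Nat.Tactic.RingSolver using (solve-∀)
open import Data.Integer.Base as ℤ using (+_)
import Data.Integer.Properties as ℤₚ
import Data.Integer.Solver as ℤ-Solver
open import Data.Rational.Base as ℚ using (ℚ; 0ℚ; 1ℚ)
import Data.Rational.Properties as ℚₚ
open import Data.Rational.Solver using (module +-*-Solver)
import Data.Rational.Unnormalised.Base as ℚᵘ
import Data.Rational.Unnormalised.Properties as ℚᵘₚ
open import Data.Fin.Base using (Fin)
open import Data.Fin.Subset using (Subset; _∩_; Empty; ∣_∣)
  renaming (_∉_ to _∉ˢ_)
open import Data.List.Base using (List; length)
open import Data.List.Membership.Propositional using () renaming (_∈_ to _∈ˡ_)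
open import Data.List.Relation.Unary.All using (All)
open import Data.List.Relation.Unary.Unique.Propositional using (Unique)
open import Data.Product.Base using (Σ; ∃-syntax; _×_; _,_; proj₁; proj₂)
open import Data.Sum.Base using (inj₁; inj₂)
open import Data.Vec.Functional using (foldr)
open import Relation.Binary.PropositionalEquality
  using (_≡_; _≢_; refl; sym; trans; cong; subst; subst₂)
open import Relation.Nullary using (¬_; yes; no; contradiction)

------------------------------------------------------------------------
-- Real numbers: Cauchy sequences of rationals, compared by the setoid
-- equality _≃ℝ_

IsCauchy : (ℕ → ℚ) → Set
IsCauchy s = ∀ ε → 0ℚ ℚ.< ε →
  ∃[ N ] (∀ m n → N ℕ.≤ m → N ℕ.≤ n → ℚ.∣ s m ℚ.- s n ∣ ℚ.< ε)

record ℝ : Set where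
  constructor mkℝ
  field
    seq    : ℕ → ℚ
    cauchy : IsCauchy seq

open ℝ public

infix 4 _≃ℝ_ _≤ℝ_

_≃ℝ_ : ℝ → ℝ → Set
x ≃ℝ y = ∀ ε → 0ℚ ℚ.< ε →
  ∃[ N ] (∀ n → N ℕ.≤ n → ℚ.∣ seq x n ℚ.- seq y n ∣ ℚ.< ε)

_≤ℝ_ : ℝ → ℝ → Set
x ≤ℝ y = ∀ ε → 0ℚ ℚ.< ε →
  ∃[ N ] (∀ n → N ℕ.≤ n → seq x n ℚ.< seq y n ℚ.+ ε)

scale : ∀ B ε → 0ℚ ℚ.< B → 0ℚ ℚ.< ε → ∃[ δ ] (0ℚ ℚ.< δ × B ℚ.* δ ≡ ε)
scale B ε 0<B 0<ε = δ , 0<δ , eq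
  where
  instance
    B-pos : ℚ.Positive B
    B-pos = ℚ.positive 0<B
    B-nz : ℚ.NonZero B
    B-nz = ℚₚ.pos⇒nonZero B
    1/B-pos : ℚ.Positive (ℚ.1/ B)
    1/B-pos = ℚₚ.1/pos⇒pos B
  δ : ℚ
  δ = ℚ.1/ B ℚ.* ε
  0<δ : 0ℚ ℚ.< δ
  0<δ = subst (ℚ._< δ) (ℚₚ.*-zeroʳ (ℚ.1/ B)) (ℚₚ.*-monoʳ-<-pos (ℚ.1/ B) 0<ε)
  eq : B ℚ.* δ ≡ ε
  eq = trans (sym (ℚₚ.*-assoc B (ℚ.1/ B) ε))
      (trans (cong (ℚ._* ε) (ℚₚ.*-inverseʳ B)) (ℚₚ.*-identityˡ ε))

0ℚ<1ℚ : 0ℚ ℚ.< 1ℚ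
0ℚ<1ℚ = ℚₚ.positive⁻¹ 1ℚ

0ℚ<2ℚ : 0ℚ ℚ.< 1ℚ ℚ.+ 1ℚ
0ℚ<2ℚ = ℚₚ.positive⁻¹ (1ℚ ℚ.+ 1ℚ)

double : ∀ δ → (1ℚ ℚ.+ 1ℚ) ℚ.* δ ≡ δ ℚ.+ δ
double = solve 1 (λ δ → (con 1ℚ :+ con 1ℚ) :* δ := δ :+ δ) refl
  where open +-*-Solver

eventuallyBounded : ∀ s → IsCauchy s →
  ∃[ B ] (0ℚ ℚ.< B × ∃[ N ] (∀ n → N ℕ.≤ n → ℚ.∣ s n ∣ ℚ.≤ B))
eventuallyBounded s c with c 1ℚ 0ℚ<1ℚ
... | N , close = B , 0<B , N , bound
  where
  B : ℚ
  B = 1ℚ ℚ.+ ℚ.∣ s N ∣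
  0<B : 0ℚ ℚ.< B
  0<B = ℚₚ.+-mono-<-≤ 0ℚ<1ℚ (ℚₚ.0≤∣p∣ (s N))
  split : ∀ a b → a ≡ (a ℚ.- b) ℚ.+ b
  split = solve 2 (λ a b → a := (a :- b) :+ b) refl
    where open +-*-Solver
  bound : ∀ n → N ℕ.≤ n → ℚ.∣ s n ∣ ℚ.≤ B
  bound n N≤n = begin
    ℚ.∣ s n ∣                        ≡⟨ cong ℚ.∣_∣ (split (s n) (s N)) ⟩
    ℚ.∣ (s n ℚ.- s N) ℚ.+ s N ∣      ≤⟨ ℚₚ.∣p+q∣≤∣p∣+∣q∣ (s n ℚ.- s N) (s N) ⟩
    ℚ.∣ s n ℚ.- s N ∣ ℚ.+ ℚ.∣ s N ∣  ≤⟨ ℚₚ.+-monoˡ-≤ ℚ.∣ s N ∣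
                                          (ℚₚ.<⇒≤ (close n N N≤n ℕₚ.≤-refl)) ⟩
    1ℚ ℚ.+ ℚ.∣ s N ∣                 ∎
    where open ℚₚ.≤-Reasoning

const-cauchy : ∀ q → IsCauchy (λ _ → q)
const-cauchy q ε 0<ε =
  0 , λ _ _ _ _ → subst (ℚ._< ε) (sym (cong ℚ.∣_∣ (ℚₚ.+-inverseʳ q))) 0<ε

+-cauchy : ∀ s t → IsCauchy s → IsCauchy t → IsCauchy (λ n → s n ℚ.+ t n)
+-cauchy s t cs ct ε 0<ε with scale (1ℚ ℚ.+ 1ℚ) ε 0ℚ<2ℚ 0<ε
... | δ , 0<δ , 2δ≡ε with cs δ 0<δ | ct δ 0<δ
... | M , closeS | N , closeT = M ℕ.⊔ N , close
  where
  rearrange : ∀ a b c d → (a ℚ.+ b) ℚ.- (c ℚ.+ d) ≡ (a ℚ.- c) ℚ.+ (b ℚ.- d)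
  rearrange = solve 4 (λ a b c d → (a :+ b) :- (c :+ d) := (a :- c) :+ (b :- d)) refl
    where open +-*-Solver
  close : ∀ m n → M ℕ.⊔ N ℕ.≤ m → M ℕ.⊔ N ℕ.≤ n →
          ℚ.∣ (s m ℚ.+ t m) ℚ.- (s n ℚ.+ t n) ∣ ℚ.< ε
  close m n ≤m ≤n = begin-strict
    ℚ.∣ (s m ℚ.+ t m) ℚ.- (s n ℚ.+ t n) ∣
      ≡⟨ cong ℚ.∣_∣ (rearrange (s m) (t m) (s n) (t n)) ⟩
    ℚ.∣ (s m ℚ.- s n) ℚ.+ (t m ℚ.- t n) ∣
      ≤⟨ ℚₚ.∣p+q∣≤∣p∣+∣q∣ (s m ℚ.- s n) (t m ℚ.- t n) ⟩
    ℚ.∣ s m ℚ.- s n ∣ ℚ.+ ℚ.∣ t m ℚ.- t n ∣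
      <⟨ ℚₚ.+-mono-<
           (closeS m n (ℕₚ.m⊔n≤o⇒m≤o M N ≤m) (ℕₚ.m⊔n≤o⇒m≤o M N ≤n))
           (closeT m n (ℕₚ.m⊔n≤o⇒n≤o M N ≤m) (ℕₚ.m⊔n≤o⇒n≤o M N ≤n)) ⟩
    δ ℚ.+ δ
      ≡⟨ trans (sym (double δ)) 2δ≡ε ⟩
    ε ∎
    where open ℚₚ.≤-Reasoning

neg-cauchy : ∀ s → IsCauchy s → IsCauchy (λ n → ℚ.- s n)
neg-cauchy s cs ε 0<ε with cs ε 0<ε
... | N , close = N , λ m n ≤m ≤n →
  subst (ℚ._< ε)
    (trans (sym (ℚₚ.∣-p∣≡∣p∣ (s m ℚ.- s n))) (cong ℚ.∣_∣ (rearrange (s m) (s n))))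
    (close m n ≤m ≤n)
  where
  rearrange : ∀ a b → ℚ.- (a ℚ.- b) ≡ (ℚ.- a) ℚ.- (ℚ.- b)
  rearrange = solve 2 (λ a b → :- (a :- b) := (:- a) :- (:- b)) refl
    where open +-*-Solver

∣*∣-bound : ∀ {C δ} p q → 0ℚ ℚ.< C → ℚ.∣ p ∣ ℚ.≤ C → ℚ.∣ q ∣ ℚ.< δ →
             ℚ.∣ p ℚ.* q ∣ ℚ.< C ℚ.* δ
∣*∣-bound {C} {δ} p q 0<C p≤C q<δ = begin-strict
  ℚ.∣ p ℚ.* q ∣         ≡⟨ ℚₚ.∣p*q∣≡∣p∣*∣q∣ p q ⟩
  ℚ.∣ p ∣ ℚ.* ℚ.∣ q ∣   ≤⟨ ℚₚ.*-monoʳ-≤-nonNeg ℚ.∣ q ∣ {{ℚₚ.∣-∣-nonNeg q}} p≤C ⟩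
  C ℚ.* ℚ.∣ q ∣         <⟨ ℚₚ.*-monoʳ-<-pos C {{ℚ.positive 0<C}} q<δ ⟩
  C ℚ.* δ               ∎
  where open ℚₚ.≤-Reasoning

∣*-*∣-bound : ∀ {A B δ} a b c d → 0ℚ ℚ.< A → 0ℚ ℚ.< B →
  ℚ.∣ a ∣ ℚ.≤ A → ℚ.∣ d ∣ ℚ.≤ B → ℚ.∣ a ℚ.- c ∣ ℚ.< δ → ℚ.∣ b ℚ.- d ∣ ℚ.< δ →
  ℚ.∣ a ℚ.* b ℚ.- c ℚ.* d ∣ ℚ.< (A ℚ.+ B) ℚ.* δ
∣*-*∣-bound {A} {B} {δ} a b c d 0<A 0<B a≤A d≤B a-c b-d = begin-strict
  ℚ.∣ a ℚ.* b ℚ.- c ℚ.* d ∣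
    ≡⟨ cong ℚ.∣_∣ (rearrange a b c d) ⟩
  ℚ.∣ a ℚ.* (b ℚ.- d) ℚ.+ d ℚ.* (a ℚ.- c) ∣
    ≤⟨ ℚₚ.∣p+q∣≤∣p∣+∣q∣ (a ℚ.* (b ℚ.- d)) (d ℚ.* (a ℚ.- c)) ⟩
  ℚ.∣ a ℚ.* (b ℚ.- d) ∣ ℚ.+ ℚ.∣ d ℚ.* (a ℚ.- c) ∣
    <⟨ ℚₚ.+-mono-< (∣*∣-bound a (b ℚ.- d) 0<A a≤A b-d) (∣*∣-bound d (a ℚ.- c) 0<B d≤B a-c) ⟩
  A ℚ.* δ ℚ.+ B ℚ.* δ
    ≡⟨ ℚₚ.*-distribʳ-+ δ A B ⟨
  (A ℚ.+ B) ℚ.* δ ∎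
  where
  open ℚₚ.≤-Reasoning
  rearrange : ∀ a b c d →
    a ℚ.* b ℚ.- c ℚ.* d ≡ a ℚ.* (b ℚ.- d) ℚ.+ d ℚ.* (a ℚ.- c)
  rearrange = solve 4 (λ a b c d →
    a :* b :- c :* d := a :* (b :- d) :+ d :* (a :- c)) refl
    where open +-*-Solver

*-cauchy : ∀ s t → IsCauchy s → IsCauchy t → IsCauchy (λ n → s n ℚ.* t n)
*-cauchy s t cs ct ε 0<ε =
  let A , 0<A , Nᴬ , boundS = eventuallyBounded s cs
      B , 0<B , Nᴮ , boundT = eventuallyBounded t ct
      δ , 0<δ , eq          = scale (A ℚ.+ B) ε (ℚₚ.+-mono-< 0<A 0<B) 0<ε
      M , closeS            = cs δ 0<δ
      N , closeT            = ct δ 0<δ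
  in combine boundS boundT closeS closeT 0<A 0<B eq
  where
  combine : ∀ {A B Nᴬ Nᴮ δ M N} →
    (∀ n → Nᴬ ℕ.≤ n → ℚ.∣ s n ∣ ℚ.≤ A) →
    (∀ n → Nᴮ ℕ.≤ n → ℚ.∣ t n ∣ ℚ.≤ B) →
    (∀ m n → M ℕ.≤ m → M ℕ.≤ n → ℚ.∣ s m ℚ.- s n ∣ ℚ.< δ) →
    (∀ m n → N ℕ.≤ m → N ℕ.≤ n → ℚ.∣ t m ℚ.- t n ∣ ℚ.< δ) →
    0ℚ ℚ.< A → 0ℚ ℚ.< B → (A ℚ.+ B) ℚ.* δ ≡ ε →
    ∃[ K ] (∀ m n → K ℕ.≤ m → K ℕ.≤ n → ℚ.∣ s m ℚ.* t m ℚ.- s n ℚ.* t n ∣ ℚ.< ε)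
  combine {A} {B} {Nᴬ} {Nᴮ} {δ} {M} {N} boundS boundT closeS closeT 0<A 0<B eq =
    (Nᴬ ℕ.⊔ Nᴮ) ℕ.⊔ (M ℕ.⊔ N) , λ m n ≤m ≤n →
    subst (ℚ.∣ s m ℚ.* t m ℚ.- s n ℚ.* t n ∣ ℚ.<_) eq
      (∣*-*∣-bound (s m) (t m) (s n) (t n) 0<A 0<B
        (boundS m (ℕₚ.m⊔n≤o⇒m≤o Nᴬ Nᴮ (left ≤m)))
        (boundT n (ℕₚ.m⊔n≤o⇒n≤o Nᴬ Nᴮ (left ≤n)))
        (closeS m n (ℕₚ.m⊔n≤o⇒m≤o M N (right ≤m)) (ℕₚ.m⊔n≤o⇒m≤o M N (right ≤n)))
        (closeT m n (ℕₚ.m⊔n≤o⇒n≤o M N (right ≤m)) (ℕₚ.m⊔n≤o⇒n≤o M N (right ≤n))))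
    where
    left : ∀ {m} → (Nᴬ ℕ.⊔ Nᴮ) ℕ.⊔ (M ℕ.⊔ N) ℕ.≤ m → Nᴬ ℕ.⊔ Nᴮ ℕ.≤ m
    left = ℕₚ.m⊔n≤o⇒m≤o (Nᴬ ℕ.⊔ Nᴮ) (M ℕ.⊔ N)
    right : ∀ {m} → (Nᴬ ℕ.⊔ Nᴮ) ℕ.⊔ (M ℕ.⊔ N) ℕ.≤ m → M ℕ.⊔ N ℕ.≤ m
    right = ℕₚ.m⊔n≤o⇒n≤o (Nᴬ ℕ.⊔ Nᴮ) (M ℕ.⊔ N)

infixl 6 _+ℝ_ _-ℝ_
infixl 7 _*ℝ_
infix  8 -ℝ_

fromℚ : ℚ → ℝ
fromℚ q = mkℝ (λ _ → q) (const-cauchy q)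

fromℕ : ℕ → ℝ
fromℕ n = fromℚ (+ n ℚ./ 1)

0ℝ 1ℝ : ℝ
0ℝ = fromℚ 0ℚ
1ℝ = fromℚ 1ℚ

_+ℝ_ : ℝ → ℝ → ℝ
x +ℝ y = mkℝ (λ n → seq x n ℚ.+ seq y n) (+-cauchy (seq x) (seq y) (cauchy x) (cauchy y))

-ℝ_ : ℝ → ℝ
-ℝ x = mkℝ (λ n → ℚ.- seq x n) (neg-cauchy (seq x) (cauchy x))

_-ℝ_ : ℝ → ℝ → ℝ
x -ℝ y = x +ℝ (-ℝ y)

_*ℝ_ : ℝ → ℝ → ℝ
x *ℝ y = mkℝ (λ n → seq x n ℚ.* seq y n) (*-cauchy (seq x) (seq y) (cauchy x) (cauchy y))

sumℝ : ∀ {n} → (Fin n → ℝ) → ℝ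
sumℝ = foldr _+ℝ_ 0ℝ

------------------------------------------------------------------------
-- Roots and rational powers of natural numbers

-- The largest a ≤ b with a ^ k ≤ N, for k ≥ 1.
searchRoot : (k N b : ℕ) → ℕ
searchRoot k N zero    = 0
searchRoot k N (suc b) with suc b ℕ.^ k ℕₚ.≤? N
... | yes _ = suc b
... | no  _ = searchRoot k N b

-- ⌊ N ^ (1 / k) ⌋ for k ≥ 1: then a ^ k ≤ N implies a ≤ N.
floorRoot : (k N : ℕ) → ℕ
floorRoot k N = searchRoot k N N

-- ⌊ N ^ (1 / k) · (j + 1) ⌋ / (j + 1)
rootSeq : (k N : ℕ) → ℕ → ℚ
rootSeq k N j = + floorRoot k (N ℕ.* suc j ℕ.^ k) ℚ./ suc j

searchRoot-lower : ∀ k N b → searchRoot (suc k) N b ℕ.^ suc k ℕ.≤ N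
searchRoot-lower k N zero = ℕ.z≤n
searchRoot-lower k N (suc b) with suc b ℕ.^ suc k ℕₚ.≤? N
... | yes p = p
... | no  _ = searchRoot-lower k N b

searchRoot-upper : ∀ k N b a → a ℕ.≤ b → a ℕ.^ k ℕ.≤ N → a ℕ.≤ searchRoot k N b
searchRoot-upper k N zero    a a≤b _ = a≤b
searchRoot-upper k N (suc b) a a≤b p with suc b ℕ.^ k ℕₚ.≤? N
... | yes _ = a≤b
... | no ¬q with ℕₚ.m≤n⇒m<n∨m≡n a≤b
...   | inj₁ (ℕ.s≤s a≤b′) = searchRoot-upper k N b a a≤b′ p
...   | inj₂ refl         = contradiction p ¬q

a≤a^1+k : ∀ k a → a ℕ.≤ a ℕ.^ suc k
a≤a^1+k k zero      = ℕ.z≤n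
a≤a^1+k k a@(suc _) = subst (ℕ._≤ a ℕ.^ suc k) (ℕₚ.^-identityʳ a)
                            (ℕₚ.^-monoʳ-≤ a {1} {suc k} (ℕ.s≤s ℕ.z≤n))

floorRoot-upper : ∀ k N → N ℕ.< suc (floorRoot (suc k) N) ℕ.^ suc k
floorRoot-upper k N = ℕₚ.≰⇒> λ p →
  ℕₚ.<-irrefl refl (searchRoot-upper (suc k) N N a (ℕₚ.≤-trans (a≤a^1+k k a) p) p)
  where
  a = suc (floorRoot (suc k) N)

^-distribʳ-* : ∀ k m n → (m ℕ.* n) ℕ.^ k ≡ m ℕ.^ k ℕ.* n ℕ.^ k
^-distribʳ-* zero    m n = refl
^-distribʳ-* (suc k) m n =
  trans (cong (m ℕ.* n ℕ.*_) (^-distribʳ-* k m n)) (swap m n (m ℕ.^ k) (n ℕ.^ k))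
  where
  swap : ∀ a b c d → a ℕ.* b ℕ.* (c ℕ.* d) ≡ a ℕ.* c ℕ.* (b ℕ.* d)
  swap = solve-∀

-- Both sides bracket N ^ (1 / k) · (i + 1) · (j + 1), with k for suc k.
floorRoot-cross : ∀ k N i j →
  floorRoot (suc k) (N ℕ.* suc i ℕ.^ suc k) ℕ.* suc j ℕ.<
  suc (floorRoot (suc k) (N ℕ.* suc j ℕ.^ suc k)) ℕ.* suc i
floorRoot-cross k N i j = ℕₚ.≰⇒> λ p →
  ℕₚ.<⇒≱ lt (ℕₚ.^-monoˡ-≤ (suc k) p)
  where
  K = suc k
  I = suc i ℕ.^ K
  J = suc j ℕ.^ K
  a = floorRoot K (N ℕ.* I)
  b = suc (floorRoot K (N ℕ.* J))
  instance
    I≢0 : ℕ.NonZero I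
    I≢0 = ℕₚ.m^n≢0 (suc i) K
  swap : ∀ x y z → x ℕ.* y ℕ.* z ≡ x ℕ.* z ℕ.* y
  swap = solve-∀
  lt : (a ℕ.* suc j) ℕ.^ K ℕ.< (b ℕ.* suc i) ℕ.^ K
  lt = begin-strict
    (a ℕ.* suc j) ℕ.^ K  ≡⟨ ^-distribʳ-* K a (suc j) ⟩
    a ℕ.^ K ℕ.* J        ≤⟨ ℕₚ.*-monoˡ-≤ J (searchRoot-lower k (N ℕ.* I) (N ℕ.* I)) ⟩
    N ℕ.* I ℕ.* J        ≡⟨ swap N I J ⟩
    N ℕ.* J ℕ.* I        <⟨ ℕₚ.*-monoˡ-< I (floorRoot-upper k (N ℕ.* J)) ⟩
    b ℕ.^ K ℕ.* I        ≡⟨ ^-distribʳ-* K b (suc i) ⟨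
    (b ℕ.* suc i) ℕ.^ K  ∎
    where open ℕₚ.≤-Reasoning

/-mono-< : ∀ a b i j → a ℕ.* suc j ℕ.< b ℕ.* suc i →
           + a ℚ./ suc i ℚ.< + b ℚ./ suc j
/-mono-< a b i j p = ℚₚ.toℚᵘ-cancel-<
  (ℚᵘₚ.<-respˡ-≃ (ℚᵘₚ.≃-sym (ℚₚ.toℚᵘ-fromℚᵘ (ℚᵘ.mkℚᵘ (+ a) i)))
  (ℚᵘₚ.<-respʳ-≃ (ℚᵘₚ.≃-sym (ℚₚ.toℚᵘ-fromℚᵘ (ℚᵘ.mkℚᵘ (+ b) j)))
  (ℚᵘ.*<* (subst₂ ℤ._<_ (ℤₚ.pos-* a (suc j)) (ℤₚ.pos-* b (suc i)) (ℤ.+<+ p)))))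

/-suc : ∀ a j → + suc a ℚ./ suc j ≡ + a ℚ./ suc j ℚ.+ + 1 ℚ./ suc j
/-suc a j = ℚₚ.toℚᵘ-injective (begin-equality
  ℚ.toℚᵘ (+ suc a ℚ./ suc j)
    ≃⟨ ℚₚ.toℚᵘ-fromℚᵘ (ℚᵘ.mkℚᵘ (+ suc a) j) ⟩
  ℚᵘ.mkℚᵘ (+ suc a) j
    ≃⟨ ℚᵘ.*≡* (arith (+ a) (+ suc j)) ⟩
  ℚᵘ.mkℚᵘ (+ a) j ℚᵘ.+ ℚᵘ.mkℚᵘ (+ 1) j
    ≃⟨ ℚᵘₚ.+-cong (ℚₚ.toℚᵘ-fromℚᵘ (ℚᵘ.mkℚᵘ (+ a) j))
                  (ℚₚ.toℚᵘ-fromℚᵘ (ℚᵘ.mkℚᵘ (+ 1) j)) ⟨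
  ℚ.toℚᵘ (+ a ℚ./ suc j) ℚᵘ.+ ℚ.toℚᵘ (+ 1 ℚ./ suc j)
    ≃⟨ ℚₚ.toℚᵘ-homo-+ (+ a ℚ./ suc j) (+ 1 ℚ./ suc j) ⟨
  ℚ.toℚᵘ (+ a ℚ./ suc j ℚ.+ + 1 ℚ./ suc j) ∎)
  where
  open ℚᵘₚ.≤-Reasoning
  arith : ∀ a d → (+ 1 ℤ.+ a) ℤ.* (d ℤ.* d) ≡ (a ℤ.* d ℤ.+ + 1 ℤ.* d) ℤ.* d
  arith = solve 2 (λ a d →
    (con (+ 1) :+ a) :* (d :* d) := (a :* d :+ con (+ 1) :* d) :* d) refl
    where open ℤ-Solver.+-*-Solver

archimedean : ∀ ε → 0ℚ ℚ.< ε → ∃[ M ] (∀ n → M ℕ.≤ n → + 1 ℚ./ suc n ℚ.< ε)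
archimedean (ℚ.mkℚ (+ zero) d c)     (ℚ.*<* (ℤ.+<+ ()))
archimedean (ℚ.mkℚ ℤ.-[1+ p ] d c)   (ℚ.*<* ())
archimedean ε@(ℚ.mkℚ (+ suc p) d c) 0<ε = suc d , λ n d<n →
  subst (+ 1 ℚ./ suc n ℚ.<_) (ℚₚ.↥p/↧p≡p ε) (/-mono-< 1 (suc p) n d (bound n d<n))
  where
  bound : ∀ n → suc d ℕ.≤ n → 1 ℕ.* suc d ℕ.< suc p ℕ.* suc n
  bound n d<n = begin-strict
    1 ℕ.* suc d      ≡⟨ ℕₚ.*-identityˡ (suc d) ⟩
    suc d            <⟨ ℕ.s≤s d<n ⟩
    suc n            ≤⟨ ℕₚ.m≤n*m (suc n) (suc p) ⟩
    suc p ℕ.* suc n  ∎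
    where open ℕₚ.≤-Reasoning

∣-∣-< : ∀ a b ε → a ℚ.< b ℚ.+ ε → b ℚ.< a ℚ.+ ε → ℚ.∣ a ℚ.- b ∣ ℚ.< ε
∣-∣-< a b ε p q with ℚₚ.∣p∣≡p∨∣p∣≡-p (a ℚ.- b)
... | inj₁ eq = subst (ℚ._< ε) (sym eq)
  (subst (a ℚ.- b ℚ.<_) (cancel b ε) (ℚₚ.+-monoˡ-< (ℚ.- b) p))
  where
  cancel : ∀ b ε → (b ℚ.+ ε) ℚ.- b ≡ ε
  cancel = solve 2 (λ b ε → (b :+ ε) :- b := ε) refl
    where open +-*-Solver
... | inj₂ eq = subst (ℚ._< ε) (sym eq)
  (subst₂ ℚ._<_ (negate a b) (cancel a ε) (ℚₚ.+-monoˡ-< (ℚ.- a) q))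
  where
  negate : ∀ a b → b ℚ.- a ≡ ℚ.- (a ℚ.- b)
  negate = solve 2 (λ a b → b :- a := :- (a :- b)) refl
    where open +-*-Solver
  cancel : ∀ b ε → (b ℚ.+ ε) ℚ.- b ≡ ε
  cancel = solve 2 (λ b ε → (b :+ ε) :- b := ε) refl
    where open +-*-Solver

rootSeq-cauchy : ∀ k N → IsCauchy (rootSeq (suc k) N)
rootSeq-cauchy k N ε 0<ε with archimedean ε 0<ε
... | M , small = M , λ m n M≤m M≤n →
  ∣-∣-< (r m) (r n) ε (step m n M≤n) (step n m M≤m)
  where
  r : ℕ → ℚ
  r = rootSeq (suc k) N
  a : ℕ → ℕ
  a j = floorRoot (suc k) (N ℕ.* suc j ℕ.^ suc k)
  step : ∀ i j → M ℕ.≤ j → r i ℚ.< r j ℚ.+ ε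
  step i j M≤j = begin-strict
    r i                     <⟨ /-mono-< (a i) (suc (a j)) i j (floorRoot-cross k N i j) ⟩
    + suc (a j) ℚ./ suc j   ≡⟨ /-suc (a j) j ⟩
    r j ℚ.+ + 1 ℚ./ suc j   <⟨ ℚₚ.+-monoʳ-< (r j) (small j M≤j) ⟩
    r j ℚ.+ ε               ∎
    where open ℚₚ.≤-Reasoning

-- N ^ (1 / k); the value at k = 0 is arbitrary.
root : (k N : ℕ) → ℝ
root zero    N = 0ℝ
root (suc k) N = mkℝ (rootSeq (suc k) N) (rootSeq-cauchy k N)

infix 8 _^[_/_]

-- n ^[ p / q ] is n ^ (p / q).
_^[_/_] : ℕ → ℕ → ℕ → ℝ
n ^[ p / q ] = root q (n ℕ.^ p)

------------------------------------------------------------------------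
-- The plane

Point : Set
Point = ℝ × ℝ

infix 4 _≈_

_≈_ : Point → Point → Set
(x , y) ≈ (x′ , y′) = x ≃ℝ x′ × y ≃ℝ y′

-- The line { (x , y) ∣ a x + b y = c }.
record Line : Set where
  field
    a b c         : ℝ
    nondegenerate : ¬ (a ≃ℝ 0ℝ × b ≃ℝ 0ℝ)

_liesOn_ : Point → Line → Set
(x , y) liesOn ℓ = a *ℝ x +ℝ b *ℝ y ≃ℝ c
  where open Line ℓ

Collinear : Point → Point → Point → Set
Collinear p q r = Σ Line λ ℓ → p liesOn ℓ × q liesOn ℓ × r liesOn ℓ

-- p is a convex combination of the points v i with i ∈ S.
_∈conv⟨_,_⟩ : ∀ {n} → Point → (Fin n → Point) → Subset n → Set
_∈conv⟨_,_⟩ {n} p v S = Σ (Fin n → ℝ) λ w →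
    (∀ i → 0ℝ ≤ℝ w i)
  × (∀ i → i ∉ˢ S → w i ≃ℝ 0ℝ)
  × sumℝ w ≃ℝ 1ℝ
  × (sumℝ (λ i → w i *ℝ proj₁ (v i)) , sumℝ (λ i → w i *ℝ proj₂ (v i))) ≈ p

------------------------------------------------------------------------
-- Geometric 3-hypergraphs

-- An edge is given by its vertex set.  By general position distinct
-- 3-subsets span distinct triangles, so counting them counts triangles.
record GeometricHypergraph (n : ℕ) : Set where
  field
    point           : Fin n → Point
    distinct        : ∀ i j → i ≢ j → ¬ (point i ≈ point j)
    generalPosition : ∀ i j l → i ≢ j → i ≢ l → j ≢ l →
                      ¬ Collinear (point i) (point j) (point l)
    edges           : List (Subset n)
    edges-unique    : Unique edges
    edges-size      : All (λ e → ∣ e ∣ ≡ 3) edges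

open GeometricHypergraph public

∣E∣ : ∀ {n} → GeometricHypergraph n → ℕ
∣E∣ H = length (edges H)

HasStronglyCrossing : ∀ {n} → ℕ → GeometricHypergraph n → Set
HasStronglyCrossing {n} k H = Σ (Fin k → Subset n) λ e →
    (∀ i → e i ∈ˡ edges H)
  × (∀ i j → i ≢ j → Empty (e i ∩ e j))
  × ∃[ p ] (∀ i → p ∈conv⟨ point H , e i ⟩)

IsMaximum : (ℕ → Set) → ℕ → Set
IsMaximum P m = P m × (∀ m′ → P m′ → m′ ℕ.≤ m)

-- IsEx₂SC k n m says m = ex₂(SCₖ³, n).
IsEx₂SC : (k n m : ℕ) → Set
IsEx₂SC k n = IsMaximum λ m →
  Σ (GeometricHypergraph n) λ H → ¬ HasStronglyCrossing k H × ∣E∣ H ≡ m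

{-# OPTIONS --safe #-}

-- Sort the points by abscissa and give each triangle acb the base ab and the
-- middle vertex c.  If m triangles share bases among n points, Cauchy-Schwarz
-- yields at least m² / n² pairs acb, adb on a common base.  To bound this
-- number, split the middle vertices by vertical lines.  At a line separating
-- two blocks of s middle vertices, the triangles acb and adb together cover
-- the stretch of the line between its intersections with cb and ad, so a
-- one-dimensional selection argument finds a point of the line stabbing many
-- pairs.  A greedy choice among the stabbed triangles would produce k disjoint
-- ones unless the number of pairs at this line is O(s^(3/2) n²).  These bounds
-- sum to O(n^(7/2)) over a dyadic subdivision, hence m = O(n^(11/4)), which is
-- O(n^(3 - 1/k)) because k ≥ 4.  Comparisons of reals are decided classically:
-- all combinatorial bounds are decidable, hence stable under double negation.
module Submission where

open import Defs
import Data.Bool.Properties as Bool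
open import Data.Bool.Base using (true; false)
open import Data.Fin.Base using (Fin; zero; suc)
open import Data.Fin.Properties using () renaming (_≟_ to _≟ᶠ_)
open import Data.Fin.Subset using (Subset; ⁅_⁆; _∪_; ∣_∣)
  renaming (_∈_ to _∈ˢ_)
open import Data.Fin.Subset.Properties
  using (x∈⁅x⁆; x∈⁅y⁆⇒x≡y; x∈p∪q⁺; x∈p∪q⁻; x∈p∩q⁻; ⊆-antisym; drop-there)
  renaming (_∈?_ to _∈ˢ?_)
import Data.Integer.Base as ℤ
import Data.Integer.Properties as ℤₚ
open import Data.List.Base
  using (List; []; _∷_; _++_; length; map; filter; cartesianProduct; take; drop; allFin; tabulate)
import Data.List.Membership.DecPropositional as DecMembership
open import Data.List.Membership.Propositional using (find)
  renaming (_∈_ to _∈ˡ_; _∉_ to _∉ˡ_)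
open import Data.List.Membership.Propositional.Properties
  using (∈-filter⁺; ∈-filter⁻; ∈-cartesianProduct⁺; ∈-cartesianProduct⁻; ∈-++⁺ʳ; ∈-allFin)
open import Data.List.Properties
  using (length-map; length-++; length-take; length-drop; length-tabulate; take++drop≡id)
open import Data.List.Relation.Binary.Permutation.Propositional using (_↭_; ↭-sym; ↭⇒↭ₛ)
open import Data.List.Relation.Binary.Permutation.Propositional.Properties
  using (↭-length; ∈-resp-↭; filter-↭)
import Data.List.Relation.Binary.Permutation.Setoid.Properties as Permutationₛ
open import Data.List.Relation.Unary.All as All using (All; []; _∷_; all?)
open import Data.List.Relation.Unary.All.Properties using (¬All⇒Any¬)
open import Data.List.Relation.Unary.AllPairs using (AllPairs; []; _∷_)
import Data.List.Relation.Unary.AllPairs.Properties as AllPairsₚ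
open import Data.List.Relation.Unary.Any using (here; there)
open import Data.List.Relation.Unary.Sorted.TotalOrder.Properties using (Sorted⇒AllPairs)
open import Data.List.Relation.Unary.Unique.Propositional using (Unique)
import Data.List.Relation.Unary.Unique.Propositional.Properties as Uniqueₚ
import Data.List.Sort as Sort
open import Data.Nat.Base
open import Data.Nat.Properties
open import Data.Nat.Tactic.RingSolver using (solve-∀)
open import Data.Product.Base using (Σ; ∃-syntax; _×_; _,_; proj₁; proj₂; swap)
open import Data.Rational.Base as ℚ using (ℚ; 0ℚ; 1ℚ)
import Data.Rational.Properties as ℚₚ
open import Data.Rational.Solver using (module +-*-Solver)
import Data.Rational.Unnormalised.Base as ℚᵘ
import Data.Rational.Unnormalised.Properties as ℚᵘₚ
open import Data.Sum.Base using (_⊎_; inj₁; inj₂)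
open import Data.Vec.Base using ([]; _∷_) renaming (there to thereᵛ)
open import Data.Vec.Functional using (foldr)
open import Data.Vec.Properties using (≡-dec)
open import Function.Base using (_∘_; id)
open import Level using (0ℓ)
open import Relation.Binary.Bundles using (DecTotalOrder)
open import Relation.Binary.Definitions using (DecidableEquality)
open import Relation.Binary.PropositionalEquality
  using (_≡_; _≢_; refl; sym; trans; cong; cong₂; subst; subst₂; setoid; module ≡-Reasoning)
open import Relation.Nullary
  using (Dec; yes; no; ¬_; ¬?; contradiction; _×-dec_; _⊎-dec_)
open import Relation.Nullary.Decidable using (decidable-stable; ¬¬-excluded-middle)
open import Relation.Unary using (Decidable)

-- Selection applied to single triangles gains nothing. A triangle acb meets a vertical line in an
-- interval with ends on ab and on cb or ac, so up to n³ intervals share about n² endpoints and the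
-- selected point has depth of order n². One vertex can already lie in that many triangles, so the
-- greedy choice might stop at once. A pair acb, adb yields instead an interval from cb to ad, whose
-- four vertices vary independently. Up to s² n² intervals on about s n endpoints at either end give
-- depth of order s² n², while only O(s n²) pairs involve a fixed vertex. The greedy choice lives on
-- this surplus factor s. It runs over pairs rather than triangles. Many pairs may select the same
-- triangle, and the bound on the pairs at a vertex already accounts for the repetition. Fractional
-- exponents are avoided by bounding squares and fourth powers of counts in ℕ. The exponent 11/4 is
-- the same for all k; in the bound on m⁴, k appears only as a linear factor of the constant.

⟦_⟧ : {P : Set} → Dec P → ℕ
⟦ yes _ ⟧ = 1
⟦ no  _ ⟧ = 0

⟦⟧≤1 : {P : Set} (d : Dec P) → ⟦ d ⟧ ≤ 1
⟦⟧≤1 (yes _) = ≤-refl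
⟦⟧≤1 (no  _) = z≤n

⟦⟧-true : {P : Set} (d : Dec P) → P → 1 ≤ ⟦ d ⟧
⟦⟧-true (yes _) _ = ≤-refl
⟦⟧-true (no ¬p) p = contradiction p ¬p

⟦⟧-map : {P Q : Set} (d : Dec P) (e : Dec Q) → (P → Q) → ⟦ d ⟧ ≤ ⟦ e ⟧
⟦⟧-map (yes p) e f = ⟦⟧-true e (f p)
⟦⟧-map (no  _) e f = z≤n

-- Finite sums over lists

module _ {A : Set} where

  ∑ : List A → (A → ℕ) → ℕ
  ∑ []       f = 0
  ∑ (x ∷ xs) f = f x + ∑ xs f

  infixr 5 ∑
  syntax ∑ xs (λ x → e) = ∑[ x ∈ xs ] e

  ∑-mono : ∀ xs {f g : A → ℕ} → (∀ x → f x ≤ g x) → ∑ xs f ≤ ∑ xs g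
  ∑-mono []       f≤g = z≤n
  ∑-mono (x ∷ xs) f≤g = +-mono-≤ (f≤g x) (∑-mono xs f≤g)

  ∑-mono-∈ : ∀ xs {f g : A → ℕ} → (∀ {x} → x ∈ˡ xs → f x ≤ g x) → ∑ xs f ≤ ∑ xs g
  ∑-mono-∈ []       f≤g = z≤n
  ∑-mono-∈ (x ∷ xs) f≤g = +-mono-≤ (f≤g (here refl)) (∑-mono-∈ xs (f≤g ∘ there))

  ∑-cong : ∀ xs {f g : A → ℕ} → (∀ x → f x ≡ g x) → ∑ xs f ≡ ∑ xs g
  ∑-cong []       f≡g = refl
  ∑-cong (x ∷ xs) f≡g = cong₂ _+_ (f≡g x) (∑-cong xs f≡g)

  ∑-const : ∀ xs c → ∑[ x ∈ xs ] c ≡ length xs * c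
  ∑-const []       c = refl
  ∑-const (x ∷ xs) c = cong (c +_) (∑-const xs c)

  ∑-bound : ∀ xs {f : A → ℕ} {c} → (∀ x → f x ≤ c) → ∑ xs f ≤ length xs * c
  ∑-bound xs {c = c} f≤c = ≤-trans (∑-mono xs f≤c) (≤-reflexive (∑-const xs c))

  ∑-++ : ∀ xs ys (f : A → ℕ) → ∑ (xs ++ ys) f ≡ ∑ xs f + ∑ ys f
  ∑-++ []       ys f = refl
  ∑-++ (x ∷ xs) ys f =
    trans (cong (f x +_) (∑-++ xs ys f)) (sym (+-assoc (f x) (∑ xs f) (∑ ys f)))

  ∑-distrib-+ : ∀ xs (f g : A → ℕ) → ∑[ x ∈ xs ] (f x + g x) ≡ ∑ xs f + ∑ xs g
  ∑-distrib-+ []       f g = refl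
  ∑-distrib-+ (x ∷ xs) f g =
    trans (cong (f x + g x +_) (∑-distrib-+ xs f g))
          (interchange (f x) (g x) (∑ xs f) (∑ xs g))
    where
    interchange : ∀ a b c d → a + b + (c + d) ≡ a + c + (b + d)
    interchange = solve-∀

  *-distribˡ-∑ : ∀ xs c (f : A → ℕ) → c * ∑ xs f ≡ ∑[ x ∈ xs ] c * f x
  *-distribˡ-∑ []       c f = *-zeroʳ c
  *-distribˡ-∑ (x ∷ xs) c f =
    trans (*-distribˡ-+ c (f x) (∑ xs f)) (cong (c * f x +_) (*-distribˡ-∑ xs c f))

  *-distribʳ-∑ : ∀ xs c (f : A → ℕ) → ∑ xs f * c ≡ ∑[ x ∈ xs ] f x * c
  *-distribʳ-∑ xs c f =
    trans (*-comm (∑ xs f) c)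
   (trans (*-distribˡ-∑ xs c f) (∑-cong xs (λ x → *-comm c (f x))))

  ∑-∈ : ∀ {xs x} (f : A → ℕ) → x ∈ˡ xs → f x ≤ ∑ xs f
  ∑-∈ f (here refl) = m≤m+n _ _
  ∑-∈ f (there x∈xs) = ≤-trans (∑-∈ f x∈xs) (m≤n+m _ _)

  ∑-filter-≤ : ∀ {P : A → Set} (P? : Decidable P) xs (f : A → ℕ) →
               ∑ (filter P? xs) f ≤ ∑ xs f
  ∑-filter-≤ P? []       f = z≤n
  ∑-filter-≤ P? (x ∷ xs) f with P? x
  ... | yes _ = +-monoʳ-≤ (f x) (∑-filter-≤ P? xs f)
  ... | no  _ = ≤-trans (∑-filter-≤ P? xs f) (m≤n+m _ (f x))

  length-filter-∑ : ∀ {P : A → Set} (P? : Decidable P) xs →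
                    length (filter P? xs) ≡ ∑[ x ∈ xs ] ⟦ P? x ⟧
  length-filter-∑ P? []       = refl
  length-filter-∑ P? (x ∷ xs) with P? x
  ... | yes _ = cong suc (length-filter-∑ P? xs)
  ... | no  _ = length-filter-∑ P? xs

∑-map : ∀ {A B : Set} (g : A → B) xs (f : B → ℕ) → ∑ (map g xs) f ≡ ∑ xs (f ∘ g)
∑-map g []       f = refl
∑-map g (x ∷ xs) f = cong (f (g x) +_) (∑-map g xs f)

module _ {A B : Set} where

  ∑-swap : ∀ (xs : List A) (ys : List B) (f : A → B → ℕ) →
           (∑[ x ∈ xs ] ∑[ y ∈ ys ] f x y) ≡ (∑[ y ∈ ys ] ∑[ x ∈ xs ] f x y)
  ∑-swap []       ys f = sym (trans (∑-const ys 0) (*-zeroʳ (length ys)))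
  ∑-swap (x ∷ xs) ys f =
    trans (cong (∑ ys (f x) +_) (∑-swap xs ys f))
          (sym (∑-distrib-+ ys (f x) (λ y → ∑[ x ∈ xs ] f x y)))

  *-∑-∑ : ∀ (xs : List A) (ys : List B) (f : A → ℕ) (g : B → ℕ) →
          ∑ xs f * ∑ ys g ≡ ∑[ x ∈ xs ] ∑[ y ∈ ys ] f x * g y
  *-∑-∑ xs ys f g = trans (*-distribʳ-∑ xs (∑ ys g) f)
                          (∑-cong xs (λ x → *-distribˡ-∑ ys (f x) g))

  ∑-× : ∀ (xs : List A) (ys : List B) (f : A × B → ℕ) →
        ∑ (cartesianProduct xs ys) f ≡ ∑[ x ∈ xs ] ∑[ y ∈ ys ] f (x , y)
  ∑-× []       ys f = refl
  ∑-× (x ∷ xs) ys f =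
    trans (∑-++ (map (x ,_) ys) (cartesianProduct xs ys) f)
          (cong₂ _+_ (∑-map (x ,_) ys f) (∑-× xs ys f))

  length-× : ∀ (xs : List A) (ys : List B) →
             length (cartesianProduct xs ys) ≡ length xs * length ys
  length-× []       ys = refl
  length-× (x ∷ xs) ys =
    trans (length-++ (map (x ,_) ys)) (cong₂ _+_ (length-map (x ,_) ys) (length-× xs ys))

-- Simultaneous induction stands in for (m - n)² ≥ 0: lowering both arguments by one changes the two
-- sides equally.
2mn≤m²+n² : ∀ m n → 2 * (m * n) ≤ m * m + n * n
2mn≤m²+n² zero    n       = z≤n
2mn≤m²+n² (suc m) zero    rewrite *-zeroʳ m = z≤n
2mn≤m²+n² (suc m) (suc n) = begin
  2 * (suc m * suc n)                      ≡⟨ lhs m n ⟩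
  2 * (m * n) + (2 * m + 2 * n + 2)        ≤⟨ +-monoˡ-≤ _ (2mn≤m²+n² m n) ⟩
  m * m + n * n + (2 * m + 2 * n + 2)      ≡⟨ rhs m n ⟩
  suc m * suc m + suc n * suc n            ∎
  where
  open ≤-Reasoning
  lhs : ∀ m n → 2 * (suc m * suc n) ≡ 2 * (m * n) + (2 * m + 2 * n + 2)
  lhs = solve-∀
  rhs : ∀ m n → m * m + n * n + (2 * m + 2 * n + 2) ≡ suc m * suc m + suc n * suc n
  rhs = solve-∀

cauchySchwarz : ∀ {A : Set} (xs : List A) (f : A → ℕ) →
                ∑ xs f * ∑ xs f ≤ length xs * (∑[ x ∈ xs ] f x * f x)
cauchySchwarz []       f = z≤n
cauchySchwarz (x ∷ xs) f = begin
  (f x + S) * (f x + S)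
    ≡⟨ expand (f x) S ⟩
  f x * f x + 2 * (f x * S) + S * S
    ≤⟨ +-mono-≤ (+-monoʳ-≤ (f x * f x) cross) (cauchySchwarz xs f) ⟩
  f x * f x + (n * (f x * f x) + Q) + n * Q
    ≡⟨ collect (f x * f x) n Q ⟩
  suc n * (f x * f x + Q) ∎
  where
  open ≤-Reasoning
  S = ∑ xs f
  Q = ∑[ y ∈ xs ] f y * f y
  n = length xs
  expand : ∀ a s → (a + s) * (a + s) ≡ a * a + 2 * (a * s) + s * s
  expand = solve-∀
  collect : ∀ a n q → a + (n * a + q) + n * q ≡ suc n * (a + q)
  collect = solve-∀
  cross : 2 * (f x * S) ≤ n * (f x * f x) + Q
  cross = begin
    2 * (f x * S)                       ≡⟨ cong (2 *_) (*-distribˡ-∑ xs (f x) f) ⟩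
    2 * (∑[ y ∈ xs ] f x * f y)         ≡⟨ *-distribˡ-∑ xs 2 (λ y → f x * f y) ⟩
    (∑[ y ∈ xs ] 2 * (f x * f y))       ≤⟨ ∑-mono xs (λ y → 2mn≤m²+n² (f x) (f y)) ⟩
    (∑[ y ∈ xs ] (f x * f x + f y * f y)) ≡⟨ ∑-distrib-+ xs (λ _ → f x * f x) (λ y → f y * f y) ⟩
      (∑[ y ∈ xs ] f x * f x) + Q       ≡⟨ cong (_+ Q) (∑-const xs (f x * f x)) ⟩
    n * (f x * f x) + Q                 ∎

-- One-dimensional selection and disjoint families

[m+n]²≤2m²+2n² : ∀ m n → (m + n) * (m + n) ≤ 2 * (m * m) + 2 * (n * n)
[m+n]²≤2m²+2n² m n = begin
  (m + n) * (m + n)                       ≡⟨ expand m n ⟩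
  m * m + n * n + 2 * (m * n)             ≤⟨ +-monoʳ-≤ (m * m + n * n) (2mn≤m²+n² m n) ⟩
  m * m + n * n + (m * m + n * n)         ≡⟨ collect (m * m) (n * n) ⟩
  2 * (m * m) + 2 * (n * n)               ∎
  where
  open ≤-Reasoning
  expand : ∀ m n → (m + n) * (m + n) ≡ m * m + n * n + 2 * (m * n)
  expand = solve-∀
  collect : ∀ a b → a + b + (a + b) ≡ 2 * a + 2 * b
  collect = solve-∀

-- Each product is charged to `k` in one of its two orientations, and transposing the double sum
-- shows that both orientations contribute equally.
∑²≤2∑∑ : ∀ {A : Set} (xs : List A) (g : A → ℕ) (k : A → A → ℕ) →
         (∀ x y → g x * g y ≤ k x y + k y x) →
         ∑ xs g * ∑ xs g ≤ 2 * (∑[ x ∈ xs ] ∑[ y ∈ xs ] k x y)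
∑²≤2∑∑ xs g k gg≤k = begin
  ∑ xs g * ∑ xs g
    ≡⟨ *-∑-∑ xs xs g g ⟩
  (∑[ x ∈ xs ] ∑[ y ∈ xs ] g x * g y)
    ≤⟨ ∑-mono xs (λ x → ∑-mono xs (gg≤k x)) ⟩
  (∑[ x ∈ xs ] ∑[ y ∈ xs ] (k x y + k y x))
    ≡⟨ ∑-cong xs (λ x → ∑-distrib-+ xs (k x) (λ y → k y x)) ⟩
  (∑[ x ∈ xs ] (∑ xs (k x) + (∑[ y ∈ xs ] k y x)))
    ≡⟨ ∑-distrib-+ xs (λ x → ∑ xs (k x)) (λ x → ∑[ y ∈ xs ] k y x) ⟩
  K + (∑[ x ∈ xs ] ∑[ y ∈ xs ] k y x)
    ≡⟨ cong (K +_) (∑-swap xs xs (λ x y → k y x)) ⟩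
  K + K
    ≡⟨ cong (K +_) (+-identityʳ K) ⟨
  2 * K ∎
  where
  open ≤-Reasoning
  K = ∑[ x ∈ xs ] ∑[ y ∈ xs ] k x y

module Selection {I : Set} (_≼_ : I → I → Set)
  (_≼?_ : ∀ i j → Dec (i ≼ j)) (total : ∀ i j → i ≼ j ⊎ j ≼ i) where

  -- Symmetric in the two ends, since the order in which two segments cross the line is not known in
  -- advance.
  Between : I → I → I → Set
  Between u v w = (u ≼ v × v ≼ w) ⊎ (w ≼ v × v ≼ u)

  between? : ∀ u v w → Dec (Between u v w)
  between? u v w = (u ≼? v ×-dec v ≼? w) ⊎-dec (w ≼? v ×-dec v ≼? u)

  private
    -- Of two endpoints on the same side of u, one lies between u and the other.
    sameSide : ∀ {P : I → Set} (P? : Decidable P) u (h : I → ℕ) → (∀ w → h w ≤ 1) →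
      (∀ v w → P v → P w → Between u v w ⊎ Between u w v) →
      ∀ v w → h v * ⟦ P? v ⟧ * (h w * ⟦ P? w ⟧) ≤
              h w * ⟦ between? u v w ⟧ + h v * ⟦ between? u w v ⟧
    sameSide P? u h h≤1 btw v w with P? v | P? w
    ... | no _  | _     rewrite *-zeroʳ (h v) = z≤n
    ... | yes _ | no _  rewrite *-zeroʳ (h w) | *-zeroʳ (h v * 1) = z≤n
    ... | yes p | yes q rewrite *-identityʳ (h v) | *-identityʳ (h w) with btw v w p q
    ...   | inj₁ b = begin
      h v * h w                                ≤⟨ *-monoˡ-≤ (h w) (h≤1 v) ⟩
      1 * h w                                  ≡⟨ *-comm 1 (h w) ⟩
      h w * 1                                  ≤⟨ *-monoʳ-≤ (h w) (⟦⟧-true (between? u v w) b) ⟩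
      h w * ⟦ between? u v w ⟧                 ≤⟨ m≤m+n _ _ ⟩
      h w * ⟦ between? u v w ⟧ + h v * ⟦ between? u w v ⟧ ∎
      where open ≤-Reasoning
    ...   | inj₂ b = begin
      h v * h w                                ≤⟨ *-monoʳ-≤ (h v) (h≤1 w) ⟩
      h v * 1                                  ≤⟨ *-monoʳ-≤ (h v) (⟦⟧-true (between? u w v) b) ⟩
      h v * ⟦ between? u w v ⟧                 ≤⟨ m≤n+m _ _ ⟩
      h w * ⟦ between? u v w ⟧ + h v * ⟦ between? u w v ⟧ ∎
      where open ≤-Reasoning

  -- Here `h` marks the intervals with one end at `u`. Among two other ends on the same side of `u`,
  -- the nearer one lies inside the interval of the farther one. The factor 8 is 2 for splitting
  -- into two sides, 2 for the two orientations of a pair, and 2 because both sides are bounded by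
  -- the same sum `K`.
  degree² : ∀ u (ws : List I) (h : I → ℕ) → (∀ w → h w ≤ 1) →
    ∑ ws h * ∑ ws h ≤ 8 * (∑[ v ∈ ws ] ∑[ w ∈ ws ] h w * ⟦ between? u v w ⟧)
  degree² u ws h h≤1 = begin
    ∑ ws h * ∑ ws h
      ≤⟨ *-mono-≤ split split ⟩
    (∑ ws up + ∑ ws down) * (∑ ws up + ∑ ws down)
      ≤⟨ [m+n]²≤2m²+2n² (∑ ws up) (∑ ws down) ⟩
    2 * (∑ ws up * ∑ ws up) + 2 * (∑ ws down * ∑ ws down)
      ≤⟨ +-mono-≤ (*-monoʳ-≤ 2 (∑²≤2∑∑ ws up k (sameSide (u ≼?_) u h h≤1 above)))
                  (*-monoʳ-≤ 2 (∑²≤2∑∑ ws down k (sameSide (_≼? u) u h h≤1 below))) ⟩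
    2 * (2 * K) + 2 * (2 * K)
      ≡⟨ collect K ⟩
    8 * K ∎
    where
    open ≤-Reasoning
    up down : I → ℕ
    up   w = h w * ⟦ u ≼? w ⟧
    down w = h w * ⟦ w ≼? u ⟧
    k : I → I → ℕ
    k v w = h w * ⟦ between? u v w ⟧
    K = ∑[ v ∈ ws ] ∑[ w ∈ ws ] k v w
    collect : ∀ K → 2 * (2 * K) + 2 * (2 * K) ≡ 8 * K
    collect = solve-∀
    above : ∀ v w → u ≼ v → u ≼ w → Between u v w ⊎ Between u w v
    above v w u≼v u≼w with total v w
    ... | inj₁ v≼w = inj₁ (inj₁ (u≼v , v≼w))
    ... | inj₂ w≼v = inj₂ (inj₁ (u≼w , w≼v))
    below : ∀ v w → v ≼ u → w ≼ u → Between u v w ⊎ Between u w v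
    below v w v≼u w≼u with total v w
    ... | inj₁ v≼w = inj₂ (inj₂ (v≼w , w≼u))
    ... | inj₂ w≼v = inj₁ (inj₂ (w≼v , v≼u))
    1≤sides : ∀ w → 1 ≤ ⟦ u ≼? w ⟧ + ⟦ w ≼? u ⟧
    1≤sides w with total u w
    ... | inj₁ u≼w = ≤-trans (⟦⟧-true (u ≼? w) u≼w) (m≤m+n _ _)
    ... | inj₂ w≼u = ≤-trans (⟦⟧-true (w ≼? u) w≼u) (m≤n+m _ _)
    split : ∑ ws h ≤ ∑ ws up + ∑ ws down
    split = begin
      ∑ ws h
        ≤⟨ ∑-mono ws (λ w → ≤-trans (≤-reflexive (sym (*-identityʳ (h w))))
                                    (*-monoʳ-≤ (h w) (1≤sides w))) ⟩
      (∑[ w ∈ ws ] h w * (⟦ u ≼? w ⟧ + ⟦ w ≼? u ⟧))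
        ≡⟨ ∑-cong ws (λ w → *-distribˡ-+ (h w) ⟦ u ≼? w ⟧ ⟦ w ≼? u ⟧) ⟩
      (∑[ w ∈ ws ] (up w + down w))
        ≡⟨ ∑-distrib-+ ws up down ⟩
      ∑ ws up + ∑ ws down ∎

  -- A one-dimensional selection lemma: if H is the incidence matrix of a set
  -- of intervals, then many intervals have a common endpoint among ws inside.
  selection : ∀ (us ws : List I) (H : I → I → ℕ) → (∀ u w → H u w ≤ 1) → ∀ D →
    (∀ v → (∑[ u ∈ us ] ∑[ w ∈ ws ] H u w * ⟦ between? u v w ⟧) ≤ D) →
    (∑[ u ∈ us ] ∑[ w ∈ ws ] H u w) * (∑[ u ∈ us ] ∑[ w ∈ ws ] H u w) ≤
    length us * (8 * (length ws * D))
  selection us ws H H≤1 D depth = begin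
    X * X
      ≤⟨ cauchySchwarz us (λ u → ∑ ws (H u)) ⟩
    length us * (∑[ u ∈ us ] ∑ ws (H u) * ∑ ws (H u))
      ≤⟨ *-monoʳ-≤ (length us) (begin
        (∑[ u ∈ us ] ∑ ws (H u) * ∑ ws (H u))
          ≤⟨ ∑-mono us (λ u → degree² u ws (H u) (H≤1 u)) ⟩
        (∑[ u ∈ us ] 8 * (∑[ v ∈ ws ] ∑[ w ∈ ws ] B u v w))
          ≡⟨ *-distribˡ-∑ us 8 (λ u → ∑[ v ∈ ws ] ∑[ w ∈ ws ] B u v w) ⟨
        8 * (∑[ u ∈ us ] ∑[ v ∈ ws ] ∑[ w ∈ ws ] B u v w)
          -- Summing over the stabbing point `v` first turns the count per endpoint `u` into the
          -- depth of `v`.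
          ≡⟨ cong (8 *_) (∑-swap us ws (λ u v → ∑[ w ∈ ws ] B u v w)) ⟩
        8 * (∑[ v ∈ ws ] ∑[ u ∈ us ] ∑[ w ∈ ws ] B u v w)
          ≤⟨ *-monoʳ-≤ 8 (∑-bound ws depth) ⟩
        8 * (length ws * D) ∎) ⟩
    length us * (8 * (length ws * D)) ∎
    where
    open ≤-Reasoning
    X = ∑[ u ∈ us ] ∑[ w ∈ ws ] H u w
    B : I → I → I → ℕ
    B u v w = H u w * ⟦ between? u v w ⟧

module _ {A V : Set} (_≟_ : DecidableEquality V) (vertices : A → List V) (r : ℕ)
  (∣vertices∣≤r : ∀ q → length (vertices q) ≤ r) where

  open DecMembership _≟_ using (_∈?_)

  private
    disjoint? : ∀ q q′ → Dec (All (_∉ˡ vertices q′) (vertices q))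
    disjoint? q q′ = all? (λ v → ¬? (v ∈? vertices q′)) (vertices q)

  -- Greedy choice: discarding all members of qs that meet a chosen one costs at most r * D.
  disjointFamily : ∀ k (qs : List A) D →
    (∀ v → (∑[ q ∈ qs ] ⟦ v ∈? vertices q ⟧) ≤ D) →
    r * D * k < length qs →
    Σ (Fin k → A) λ f → (∀ i → f i ∈ˡ qs) ×
      (∀ i j → i ≢ j → ∀ {v} → v ∈ˡ vertices (f i) → v ∉ˡ vertices (f j))
  disjointFamily zero    qs D deg big = (λ ()) , (λ ()) , λ ()
  disjointFamily (suc k) qs@(q ∷ _) D deg big = g , g∈qs , g-disjoint
    where
    -- `q` is filtered together with the others, so its own removal is already part of the loss
    -- `r * D`.
    rest = filter (disjoint? q) qs
    cover : ∀ q′ → 1 ≤ ⟦ disjoint? q q′ ⟧ + (∑[ v ∈ vertices q ] ⟦ v ∈? vertices q′ ⟧)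
    cover q′ with disjoint? q q′
    ... | yes _ = s≤s z≤n
    ... | no ¬p with find (¬All⇒Any¬ (λ v → ¬? (v ∈? vertices q′)) (vertices q) ¬p)
    ...   | v , v∈q , ¬¬v∈q′ =
      ≤-trans (⟦⟧-true (v ∈? vertices q′) (decidable-stable (v ∈? vertices q′) ¬¬v∈q′))
              (∑-∈ (λ v → ⟦ v ∈? vertices q′ ⟧) v∈q)
    loss : length qs ≤ length rest + r * D
    loss = begin
      length qs
        ≡⟨ trans (∑-const qs 1) (*-identityʳ (length qs)) ⟨
      (∑[ q′ ∈ qs ] 1)
        ≤⟨ ∑-mono qs cover ⟩
      (∑[ q′ ∈ qs ] (⟦ disjoint? q q′ ⟧ + (∑[ v ∈ vertices q ] ⟦ v ∈? vertices q′ ⟧)))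
        ≡⟨ ∑-distrib-+ qs (λ q′ → ⟦ disjoint? q q′ ⟧)
                             (λ q′ → ∑[ v ∈ vertices q ] ⟦ v ∈? vertices q′ ⟧) ⟩
      (∑[ q′ ∈ qs ] ⟦ disjoint? q q′ ⟧) +
      (∑[ q′ ∈ qs ] ∑[ v ∈ vertices q ] ⟦ v ∈? vertices q′ ⟧)
        ≡⟨ cong₂ _+_ (sym (length-filter-∑ (disjoint? q) qs))
                     (∑-swap qs (vertices q) (λ q′ v → ⟦ v ∈? vertices q′ ⟧)) ⟩
      length rest + (∑[ v ∈ vertices q ] ∑[ q′ ∈ qs ] ⟦ v ∈? vertices q′ ⟧)
        ≤⟨ +-monoʳ-≤ (length rest)
             (≤-trans (∑-bound (vertices q) deg) (*-monoˡ-≤ D (∣vertices∣≤r q))) ⟩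
      length rest + r * D ∎
      where open ≤-Reasoning
    big′ : r * D * k < length rest
    big′ = +-cancelʳ-< (r * D) (r * D * k) (length rest) (begin-strict
      r * D * k + r * D  ≡⟨ +-comm (r * D * k) (r * D) ⟩
      r * D + r * D * k  ≡⟨ *-suc (r * D) k ⟨
      r * D * suc k      <⟨ big ⟩
      length qs          ≤⟨ loss ⟩
      length rest + r * D ∎)
      where open ≤-Reasoning
    rec = disjointFamily k rest D (λ v → ≤-trans (∑-filter-≤ (disjoint? q) qs _) (deg v)) big′
    f = proj₁ rec
    f∈ : ∀ i → f i ∈ˡ qs × All (_∉ˡ vertices (f i)) (vertices q)
    f∈ i = ∈-filter⁻ (disjoint? q) (proj₁ (proj₂ rec) i)
    g : Fin (suc k) → A
    g zero    = q
    g (suc i) = f i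
    g∈qs : ∀ i → g i ∈ˡ qs
    g∈qs zero    = here refl
    g∈qs (suc i) = proj₁ (f∈ i)
    g-disjoint : ∀ i j → i ≢ j → ∀ {v} → v ∈ˡ vertices (g i) → v ∉ˡ vertices (g j)
    g-disjoint zero    zero    0≢0 = contradiction refl 0≢0
    g-disjoint zero    (suc j) _   = All.lookup (proj₂ (f∈ j))
    g-disjoint (suc i) zero    _ v∈f v∈q = All.lookup (proj₂ (f∈ i)) v∈q v∈f
    g-disjoint (suc i) (suc j) i≢j = proj₂ (proj₂ rec) i j (i≢j ∘ cong suc)

-- Real numbers

-- Opaque, since normalising the witnesses makes type checking intractable.
abstract
  half : ∀ ε → 0ℚ ℚ.< ε → ∃[ δ ] (0ℚ ℚ.< δ × δ ℚ.+ δ ≡ ε)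
  half ε 0<ε with scale (1ℚ ℚ.+ 1ℚ) ε 0ℚ<2ℚ 0<ε
  ... | δ , 0<δ , 2δ≡ε = δ , 0<δ , trans (sym (double δ)) 2δ≡ε

  quotient : ∀ B ε → 0ℚ ℚ.< B → 0ℚ ℚ.< ε → ∃[ δ ] (0ℚ ℚ.< δ × B ℚ.* δ ≡ ε)
  quotient = scale

  bounded : ∀ x → ∃[ B ] (0ℚ ℚ.< B × ∃[ N ] (∀ n → N ≤ n → ℚ.∣ seq x n ∣ ℚ.≤ B))
  bounded x = eventuallyBounded (seq x) (cauchy x)

∣p∣<ε⇒0<p+ε : ∀ {ε} p → ℚ.∣ p ∣ ℚ.< ε → 0ℚ ℚ.< p ℚ.+ ε
∣p∣<ε⇒0<p+ε {ε} p ∣p∣<ε = begin-strict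
  0ℚ                      ≤⟨ 0≤p+∣p∣ (ℚₚ.∣p∣≡p∨∣p∣≡-p p) ⟩
  p ℚ.+ ℚ.∣ p ∣           <⟨ ℚₚ.+-monoʳ-< p ∣p∣<ε ⟩
  p ℚ.+ ε                 ∎
  where
  open ℚₚ.≤-Reasoning
  0≤p+∣p∣ : ℚ.∣ p ∣ ≡ p ⊎ ℚ.∣ p ∣ ≡ ℚ.- p → 0ℚ ℚ.≤ p ℚ.+ ℚ.∣ p ∣
  0≤p+∣p∣ (inj₁ eq) = ℚₚ.+-mono-≤ (ℚₚ.∣p∣≡p⇒0≤p eq) (ℚₚ.0≤∣p∣ p)
  0≤p+∣p∣ (inj₂ eq) = ℚₚ.≤-reflexive (sym (trans (cong (p ℚ.+_) eq) (ℚₚ.+-inverseʳ p)))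

eventually-≡⇒≃ : ∀ x y N → (∀ n → N ≤ n → seq x n ≡ seq y n) → x ≃ℝ y
eventually-≡⇒≃ x y N eq ε 0<ε = N , λ n N≤n →
  subst (ℚ._< ε)
    (sym (trans (cong (λ p → ℚ.∣ p ℚ.- seq y n ∣) (eq n N≤n))
                (cong ℚ.∣_∣ (ℚₚ.+-inverseʳ (seq y n))))) 0<ε

pointwise⇒≃ : ∀ x y → (∀ n → seq x n ≡ seq y n) → x ≃ℝ y
pointwise⇒≃ x y eq = eventually-≡⇒≃ x y 0 (λ n _ → eq n)

≃-refl : ∀ x → x ≃ℝ x
≃-refl x = pointwise⇒≃ x x (λ _ → refl)

≃-trans : ∀ x y z → x ≃ℝ y → y ≃ℝ z → x ≃ℝ z
≃-trans x y z x≃y y≃z ε 0<ε with half ε 0<ε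
... | δ , 0<δ , refl with x≃y δ 0<δ | y≃z δ 0<δ
... | M , p | N , q = M ⊔ N , λ n ≤n → begin-strict
  ℚ.∣ seq x n ℚ.- seq z n ∣
    ≡⟨ cong ℚ.∣_∣ (split (seq x n) (seq y n) (seq z n)) ⟩
  ℚ.∣ (seq x n ℚ.- seq y n) ℚ.+ (seq y n ℚ.- seq z n) ∣
    ≤⟨ ℚₚ.∣p+q∣≤∣p∣+∣q∣ (seq x n ℚ.- seq y n) (seq y n ℚ.- seq z n) ⟩
  ℚ.∣ seq x n ℚ.- seq y n ∣ ℚ.+ ℚ.∣ seq y n ℚ.- seq z n ∣
    <⟨ ℚₚ.+-mono-< (p n (m⊔n≤o⇒m≤o M N ≤n)) (q n (m⊔n≤o⇒n≤o M N ≤n)) ⟩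
  δ ℚ.+ δ ∎
  where
  open ℚₚ.≤-Reasoning
  split : ∀ a b c → a ℚ.- c ≡ (a ℚ.- b) ℚ.+ (b ℚ.- c)
  split = solve 3 (λ a b c → a :- c := (a :- b) :+ (b :- c)) refl
    where open +-*-Solver

+ℝ-cong : ∀ x x′ y y′ → x ≃ℝ x′ → y ≃ℝ y′ → x +ℝ y ≃ℝ x′ +ℝ y′
+ℝ-cong x x′ y y′ x≃x′ y≃y′ ε 0<ε with half ε 0<ε
... | δ , 0<δ , refl with x≃x′ δ 0<δ | y≃y′ δ 0<δ
... | M , p | N , q = M ⊔ N , λ n ≤n → begin-strict
  ℚ.∣ (seq x n ℚ.+ seq y n) ℚ.- (seq x′ n ℚ.+ seq y′ n) ∣
    ≡⟨ cong ℚ.∣_∣ (rearrange (seq x n) (seq y n) (seq x′ n) (seq y′ n)) ⟩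
  ℚ.∣ (seq x n ℚ.- seq x′ n) ℚ.+ (seq y n ℚ.- seq y′ n) ∣
    ≤⟨ ℚₚ.∣p+q∣≤∣p∣+∣q∣ (seq x n ℚ.- seq x′ n) (seq y n ℚ.- seq y′ n) ⟩
  ℚ.∣ seq x n ℚ.- seq x′ n ∣ ℚ.+ ℚ.∣ seq y n ℚ.- seq y′ n ∣
    <⟨ ℚₚ.+-mono-< (p n (m⊔n≤o⇒m≤o M N ≤n)) (q n (m⊔n≤o⇒n≤o M N ≤n)) ⟩
  δ ℚ.+ δ ∎
  where
  open ℚₚ.≤-Reasoning
  rearrange : ∀ a b c d → (a ℚ.+ b) ℚ.- (c ℚ.+ d) ≡ (a ℚ.- c) ℚ.+ (b ℚ.- d)
  rearrange = solve 4 (λ a b c d → (a :+ b) :- (c :+ d) := (a :- c) :+ (b :- d)) refl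
    where open +-*-Solver

*ℝ-congˡ : ∀ x y y′ → y ≃ℝ y′ → x *ℝ y ≃ℝ x *ℝ y′
*ℝ-congˡ x y y′ y≃y′ ε 0<ε with bounded x
... | B , 0<B , M , bound with quotient B ε 0<B 0<ε
... | δ , 0<δ , refl with y≃y′ δ 0<δ
... | N , close = M ⊔ N , λ n ≤n →
  subst (ℚ._< B ℚ.* δ) (cong ℚ.∣_∣ (distrib (seq x n) (seq y n) (seq y′ n)))
    (∣*∣-bound (seq x n) (seq y n ℚ.- seq y′ n) 0<B
      (bound n (m⊔n≤o⇒m≤o M N ≤n)) (close n (m⊔n≤o⇒n≤o M N ≤n)))
  where
  distrib : ∀ a b c → a ℚ.* (b ℚ.- c) ≡ a ℚ.* b ℚ.- a ℚ.* c
  distrib = solve 3 (λ a b c → a :* (b :- c) := a :* b :- a :* c) refl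
    where open +-*-Solver

infix 4 _<ℝ_

-- The explicit rational gap keeps y - x away from 0 from some index on, which is what the
-- reciprocal in `interpolate` needs.
_<ℝ_ : ℝ → ℝ → Set
x <ℝ y = ∃[ δ ] (0ℚ ℚ.< δ × ∃[ N ] (∀ n → N ≤ n → δ ℚ.≤ seq y n ℚ.- seq x n))

≤ℝ-trans : ∀ x y z → x ≤ℝ y → y ≤ℝ z → x ≤ℝ z
≤ℝ-trans x y z x≤y y≤z ε 0<ε with half ε 0<ε
... | δ , 0<δ , refl with x≤y δ 0<δ | y≤z δ 0<δ
... | M , p | N , q = M ⊔ N , λ n ≤n → begin-strict
  seq x n                 <⟨ p n (m⊔n≤o⇒m≤o M N ≤n) ⟩
  seq y n ℚ.+ δ           <⟨ ℚₚ.+-monoˡ-< δ (q n (m⊔n≤o⇒n≤o M N ≤n)) ⟩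
  (seq z n ℚ.+ δ) ℚ.+ δ   ≡⟨ ℚₚ.+-assoc (seq z n) δ δ ⟩
  seq z n ℚ.+ (δ ℚ.+ δ)   ∎
  where open ℚₚ.≤-Reasoning

≤ℝ-antisym : ∀ x y → x ≤ℝ y → y ≤ℝ x → x ≃ℝ y
≤ℝ-antisym x y x≤y y≤x ε 0<ε with x≤y ε 0<ε | y≤x ε 0<ε
... | M , p | N , q = M ⊔ N , λ n ≤n →
  ∣-∣-< (seq x n) (seq y n) ε (p n (m⊔n≤o⇒m≤o M N ≤n)) (q n (m⊔n≤o⇒n≤o M N ≤n))

pointwise⇒≤ : ∀ x y → (∀ n → seq x n ℚ.≤ seq y n) → x ≤ℝ y
pointwise⇒≤ x y x≤y ε 0<ε = 0 , λ n _ → begin-strict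
  seq x n            ≤⟨ x≤y n ⟩
  seq y n            ≡⟨ ℚₚ.+-identityʳ (seq y n) ⟨
  seq y n ℚ.+ 0ℚ     <⟨ ℚₚ.+-monoʳ-< (seq y n) 0<ε ⟩
  seq y n ℚ.+ ε      ∎
  where open ℚₚ.≤-Reasoning

≤ℝ-refl : ∀ x → x ≤ℝ x
≤ℝ-refl x = pointwise⇒≤ x x (λ _ → ℚₚ.≤-refl)

<ℝ⇒≤ℝ : ∀ x y → x <ℝ y → x ≤ℝ y
<ℝ⇒≤ℝ x y (δ , 0<δ , N , gap) ε 0<ε = N , λ n N≤n → begin-strict
  seq x n                                      ≡⟨ ℚₚ.+-identityʳ (seq x n) ⟨
  seq x n ℚ.+ 0ℚ                               ≤⟨ ℚₚ.+-monoʳ-≤ (seq x n)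
                                                  (ℚₚ.≤-trans (ℚₚ.<⇒≤ 0<δ) (gap n N≤n)) ⟩
  seq x n ℚ.+ (seq y n ℚ.- seq x n)            ≡⟨ cancel (seq x n) (seq y n) ⟩
  seq y n ℚ.+ 0ℚ                               <⟨ ℚₚ.+-monoʳ-< (seq y n) 0<ε ⟩
  seq y n ℚ.+ ε                                ∎
  where
  open ℚₚ.≤-Reasoning
  cancel : ∀ a b → a ℚ.+ (b ℚ.- a) ≡ b ℚ.+ 0ℚ
  cancel = solve 2 (λ a b → a :+ (b :- a) := b :+ con 0ℚ) refl
    where open +-*-Solver

<ℝ-≤ℝ-irrefl : ∀ x y → x <ℝ y → ¬ y ≤ℝ x
<ℝ-≤ℝ-irrefl x y (δ , 0<δ , M , gap) y≤x with y≤x δ 0<δ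
... | N , q = ℚₚ.<-irrefl refl (begin-strict
  seq y n                                 <⟨ q n (m≤n⊔m M N) ⟩
  seq x n ℚ.+ δ                           ≤⟨ ℚₚ.+-monoʳ-≤ (seq x n) (gap n (m≤m⊔n M N)) ⟩
  seq x n ℚ.+ (seq y n ℚ.- seq x n)       ≡⟨ cancel (seq x n) (seq y n) ⟩
  seq y n                                 ∎)
  where
  open ℚₚ.≤-Reasoning
  n = M ⊔ N
  cancel : ∀ a b → a ℚ.+ (b ℚ.- a) ≡ b
  cancel = solve 2 (λ a b → a :+ (b :- a) := b) refl
    where open +-*-Solver

-- With δ = ε / 4, a gap of 3δ at a single late index persists as a gap of δ.
≮ℝ⇒≥ℝ : ∀ x y → ¬ x <ℝ y → y ≤ℝ x
≮ℝ⇒≥ℝ x y x≮y ε 0<ε with half ε 0<ε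
... | ε₂ , 0<ε₂ , refl with half ε₂ 0<ε₂
... | δ , 0<δ , refl with cauchy x δ 0<δ | cauchy y δ 0<δ
... | M , closeX | N , closeY = M ⊔ N , λ n ≤n → ℚₚ.≰⇒> λ gap →
  x≮y (δ , 0<δ , M ⊔ N , λ m ≤m → begin
    δ
      ≡⟨ shift (seq x n) δ ⟩
    ((seq x n ℚ.+ (δ ℚ.+ δ ℚ.+ (δ ℚ.+ δ))) ℚ.- δ) ℚ.- (seq x n ℚ.+ δ) ℚ.- δ
      ≤⟨ ℚₚ.+-monoˡ-≤ (ℚ.- δ) (ℚₚ.+-mono-≤
           (ℚₚ.≤-trans (ℚₚ.+-monoˡ-≤ (ℚ.- δ) gap)
             (below (seq y m) (seq y n) (closeY m n (right ≤m) (right ≤n))))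
           (ℚₚ.neg-antimono-≤
             (above (seq x m) (seq x n) (closeX n m (left ≤n) (left ≤m))))) ⟩
    seq y m ℚ.- (seq x m) ℚ.- δ
      ≤⟨ ℚₚ.+-monoʳ-≤ (seq y m ℚ.- seq x m) (ℚₚ.<⇒≤ (ℚₚ.neg-antimono-< 0<δ)) ⟩
    seq y m ℚ.- seq x m ℚ.+ 0ℚ
      ≡⟨ ℚₚ.+-identityʳ _ ⟩
    seq y m ℚ.- seq x m ∎)
  where
  open ℚₚ.≤-Reasoning
  left : ∀ {m} → M ⊔ N ≤ m → M ≤ m
  left = m⊔n≤o⇒m≤o M N
  right : ∀ {m} → M ⊔ N ≤ m → N ≤ m
  right = m⊔n≤o⇒n≤o M N
  shift : ∀ a δ → δ ≡ ((a ℚ.+ (δ ℚ.+ δ ℚ.+ (δ ℚ.+ δ))) ℚ.- δ) ℚ.- (a ℚ.+ δ) ℚ.- δ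
  shift = solve 2 (λ a δ → δ := ((a :+ (δ :+ δ :+ (δ :+ δ))) :- δ) :- (a :+ δ) :- δ) refl
    where open +-*-Solver
  above : ∀ a b → ℚ.∣ b ℚ.- a ∣ ℚ.< δ → a ℚ.≤ b ℚ.+ δ
  above a b close = begin
    a                             ≡⟨ ℚₚ.+-identityʳ a ⟨
    a ℚ.+ 0ℚ                      ≤⟨ ℚₚ.+-monoʳ-≤ a
                                       (ℚₚ.<⇒≤ (∣p∣<ε⇒0<p+ε (b ℚ.- a) close)) ⟩
    a ℚ.+ ((b ℚ.- a) ℚ.+ δ)       ≡⟨ cancel a b δ ⟩
    b ℚ.+ δ                       ∎
    where
    cancel : ∀ a b δ → a ℚ.+ ((b ℚ.- a) ℚ.+ δ) ≡ b ℚ.+ δ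
    cancel = solve 3 (λ a b δ → a :+ ((b :- a) :+ δ) := b :+ δ) refl
      where open +-*-Solver
  below : ∀ a b → ℚ.∣ a ℚ.- b ∣ ℚ.< δ → b ℚ.- δ ℚ.≤ a
  below a b close = begin
    b ℚ.- δ                             ≡⟨ ℚₚ.+-identityʳ (b ℚ.- δ) ⟨
    b ℚ.- δ ℚ.+ 0ℚ                      ≤⟨ ℚₚ.+-monoʳ-≤ (b ℚ.- δ)
                                             (ℚₚ.<⇒≤ (∣p∣<ε⇒0<p+ε (a ℚ.- b) close)) ⟩
    b ℚ.- δ ℚ.+ ((a ℚ.- b) ℚ.+ δ)       ≡⟨ cancel a b δ ⟩
    a                                   ∎
    where
    cancel : ∀ a b δ → b ℚ.- δ ℚ.+ ((a ℚ.- b) ℚ.+ δ) ≡ a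
    cancel = solve 3 (λ a b δ → b :- δ :+ ((a :- b) :+ δ) := a) refl
      where open +-*-Solver

0≤+ : ∀ x y → 0ℝ ≤ℝ x → 0ℝ ≤ℝ y → 0ℝ ≤ℝ x +ℝ y
0≤+ x y 0≤x 0≤y ε 0<ε with half ε 0<ε
... | δ , 0<δ , refl with 0≤x δ 0<δ | 0≤y δ 0<δ
... | M , p | N , q = M ⊔ N , λ n ≤n →
  subst (0ℚ ℚ.<_) (interchange (seq x n) (seq y n) δ)
    (ℚₚ.+-mono-< (p n (m⊔n≤o⇒m≤o M N ≤n)) (q n (m⊔n≤o⇒n≤o M N ≤n)))
  where
  interchange : ∀ a b δ → (a ℚ.+ δ) ℚ.+ (b ℚ.+ δ) ≡ a ℚ.+ b ℚ.+ (δ ℚ.+ δ)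
  interchange = solve 3 (λ a b δ → (a :+ δ) :+ (b :+ δ) := a :+ b :+ (δ :+ δ)) refl
    where open +-*-Solver

negative-small : ∀ {δ} r → 0ℚ ℚ.< δ → ¬ 0ℚ ℚ.≤ r → 0ℚ ℚ.< r ℚ.+ δ → ℚ.∣ r ∣ ℚ.< δ
negative-small {δ} r 0<δ 0≰r 0<r+δ = subst (ℚ._< δ) (cong ℚ.∣_∣ (ℚₚ.+-identityʳ r))
  (∣-∣-< r 0ℚ δ (subst (r ℚ.<_) (sym (ℚₚ.+-identityˡ δ)) (ℚₚ.<-trans (ℚₚ.≰⇒> 0≰r) 0<δ)) 0<r+δ)

-- A negative factor exceeds -δ, hence has absolute value below δ, and the other factor is at most
-- `B` in absolute value. Otherwise both factors are nonnegative.
0≤p*q+Bδ : ∀ {B δ} p q → 0ℚ ℚ.< B → 0ℚ ℚ.< δ → ℚ.∣ p ∣ ℚ.≤ B → ℚ.∣ q ∣ ℚ.≤ B →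
           0ℚ ℚ.< p ℚ.+ δ → 0ℚ ℚ.< q ℚ.+ δ → 0ℚ ℚ.< p ℚ.* q ℚ.+ B ℚ.* δ
0≤p*q+Bδ {B} {δ} p q 0<B 0<δ ∣p∣≤B ∣q∣≤B 0<p+δ 0<q+δ with 0ℚ ℚₚ.≤? p | 0ℚ ℚₚ.≤? q
... | yes 0≤p | yes 0≤q = ℚₚ.+-mono-≤-< 0≤pq 0<Bδ
  where
  0≤pq : 0ℚ ℚ.≤ p ℚ.* q
  0≤pq = ℚₚ.nonNegative⁻¹ (p ℚ.* q)
    {{ℚₚ.nonNeg*nonNeg⇒nonNeg p {{ℚ.nonNegative 0≤p}} q {{ℚ.nonNegative 0≤q}}}}
  0<Bδ : 0ℚ ℚ.< B ℚ.* δ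
  0<Bδ = subst (ℚ._< B ℚ.* δ) (ℚₚ.*-zeroʳ B) (ℚₚ.*-monoʳ-<-pos B {{ℚ.positive 0<B}} 0<δ)
... | _ | no 0≰q = ∣p∣<ε⇒0<p+ε (p ℚ.* q) (∣*∣-bound p q 0<B ∣p∣≤B (negative-small q 0<δ 0≰q 0<q+δ))
... | no 0≰p | yes _ = subst (λ pq → 0ℚ ℚ.< pq ℚ.+ B ℚ.* δ) (ℚₚ.*-comm q p)
    (∣p∣<ε⇒0<p+ε (q ℚ.* p) (∣*∣-bound q p 0<B ∣q∣≤B (negative-small p 0<δ 0≰p 0<p+δ)))

0≤* : ∀ x y → 0ℝ ≤ℝ x → 0ℝ ≤ℝ y → 0ℝ ≤ℝ x *ℝ y
0≤* x y 0≤x 0≤y ε 0<ε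
  with bounded x | bounded y
... | A , 0<A , K , boundX | B , 0<B , L , boundY
  with quotient (A ℚ.+ B) ε (ℚₚ.+-mono-< 0<A 0<B) 0<ε
... | δ , 0<δ , refl with 0≤x δ 0<δ | 0≤y δ 0<δ
... | M , p | N , q = (K ⊔ L) ⊔ (M ⊔ N) , λ n ≤n →
  let ≤ˡ = m⊔n≤o⇒m≤o (K ⊔ L) (M ⊔ N) ≤n
      ≤ʳ = m⊔n≤o⇒n≤o (K ⊔ L) (M ⊔ N) ≤n
  in 0≤p*q+Bδ (seq x n) (seq y n) (ℚₚ.+-mono-< 0<A 0<B) 0<δ
       (ℚₚ.≤-trans (boundX n (m⊔n≤o⇒m≤o K L ≤ˡ)) A≤A+B)
       (ℚₚ.≤-trans (boundY n (m⊔n≤o⇒n≤o K L ≤ˡ)) B≤A+B)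
       (p n (m⊔n≤o⇒m≤o M N ≤ʳ)) (q n (m⊔n≤o⇒n≤o M N ≤ʳ))
  where
  A≤A+B : A ℚ.≤ A ℚ.+ B
  A≤A+B = subst (ℚ._≤ A ℚ.+ B) (ℚₚ.+-identityʳ A) (ℚₚ.+-monoʳ-≤ A (ℚₚ.<⇒≤ 0<B))
  B≤A+B : B ℚ.≤ A ℚ.+ B
  B≤A+B = subst (ℚ._≤ A ℚ.+ B) (ℚₚ.+-identityˡ B) (ℚₚ.+-monoˡ-≤ B (ℚₚ.<⇒≤ 0<A))

0≤- : ∀ x y → x ≤ℝ y → 0ℝ ≤ℝ y -ℝ x
0≤- x y x≤y ε 0<ε with x≤y ε 0<ε
... | N , p = N , λ n N≤n →
  subst₂ ℚ._<_ (ℚₚ.+-inverseʳ (seq x n)) (rearrange (seq x n) (seq y n) ε)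
    (ℚₚ.+-monoˡ-< (ℚ.- seq x n) (p n N≤n))
  where
  rearrange : ∀ a b ε → (b ℚ.+ ε) ℚ.- a ≡ (b ℚ.- a) ℚ.+ ε
  rearrange = solve 3 (λ a b ε → (b :+ ε) :- a := (b :- a) :+ ε) refl
    where open +-*-Solver

-- 1 / p for p ≥ δ, and the junk value 0 otherwise.
recip : ∀ δ → 0ℚ ℚ.< δ → ℚ → ℚ
recip δ 0<δ p with δ ℚₚ.≤? p
... | no  _   = 0ℚ
... | yes δ≤p = (ℚ.1/ p) {{ℚₚ.pos⇒nonZero p {{ℚ.positive (ℚₚ.<-≤-trans 0<δ δ≤p)}}}}

recip-inverse : ∀ δ (0<δ : 0ℚ ℚ.< δ) p → δ ℚ.≤ p → recip δ 0<δ p ℚ.* p ≡ 1ℚ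
recip-inverse δ 0<δ p δ≤p with δ ℚₚ.≤? p
... | no  δ≰p = contradiction δ≤p δ≰p
... | yes δ≤p = ℚₚ.*-inverseˡ p {{ℚₚ.pos⇒nonZero p {{ℚ.positive (ℚₚ.<-≤-trans 0<δ δ≤p)}}}}

0≤recip : ∀ δ (0<δ : 0ℚ ℚ.< δ) p → 0ℚ ℚ.≤ recip δ 0<δ p
0≤recip δ 0<δ p with δ ℚₚ.≤? p
... | no  _   = ℚₚ.≤-refl
... | yes δ≤p = ℚₚ.<⇒≤ (ℚₚ.positive⁻¹ _ {{ℚₚ.1/pos⇒pos p {{ℚ.positive (ℚₚ.<-≤-trans 0<δ δ≤p)}}}})

recip-bound : ∀ δ (0<δ : 0ℚ ℚ.< δ) p e → δ ℚ.* e ≡ 1ℚ → 0ℚ ℚ.< e → δ ℚ.≤ p →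
              ℚ.∣ recip δ 0<δ p ∣ ℚ.≤ e
recip-bound δ 0<δ p e δe≡1 0<e δ≤p = begin
  ℚ.∣ r ∣             ≡⟨ ℚₚ.0≤p⇒∣p∣≡p (0≤recip δ 0<δ p) ⟩
  r                   ≡⟨ ℚₚ.*-identityʳ r ⟨
  r ℚ.* 1ℚ            ≡⟨ cong (r ℚ.*_) δe≡1 ⟨
  r ℚ.* (δ ℚ.* e)     ≤⟨ ℚₚ.*-monoˡ-≤-nonNeg r {{ℚ.nonNegative (0≤recip δ 0<δ p)}}
                          (ℚₚ.*-monoʳ-≤-nonNeg e {{ℚ.nonNegative (ℚₚ.<⇒≤ 0<e)}} δ≤p) ⟩
  r ℚ.* (p ℚ.* e)     ≡⟨ ℚₚ.*-assoc r p e ⟨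
  r ℚ.* p ℚ.* e       ≡⟨ cong (ℚ._* e) (recip-inverse δ 0<δ p δ≤p) ⟩
  1ℚ ℚ.* e            ≡⟨ ℚₚ.*-identityˡ e ⟩
  e                   ∎
  where
  open ℚₚ.≤-Reasoning
  r = recip δ 0<δ p

-- From 1/p - 1/q = (1/p)(1/q)(q - p), where each reciprocal is at most `e` = 1/δ. This is why ε is
-- divided by `e` twice.
recip-cauchy : ∀ s → IsCauchy s → ∀ δ (0<δ : 0ℚ ℚ.< δ) N → (∀ n → N ≤ n → δ ℚ.≤ s n) →
               IsCauchy (λ n → recip δ 0<δ (s n))
recip-cauchy s cs δ 0<δ N δ≤s ε 0<ε with quotient δ 1ℚ 0<δ 0ℚ<1ℚ
... | e , 0<e , δe≡1 with quotient e ε 0<e 0<ε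
... | ε₁ , 0<ε₁ , refl with quotient e ε₁ 0<e 0<ε₁
... | ε₂ , 0<ε₂ , refl with cs ε₂ 0<ε₂
... | M , close = N ⊔ M , λ m n ≤m ≤n →
  let δ≤sm = δ≤s m (m⊔n≤o⇒m≤o N M ≤m)
      δ≤sn = δ≤s n (m⊔n≤o⇒m≤o N M ≤n)
      rm = recip δ 0<δ (s m)
      rn = recip δ 0<δ (s n)
  in subst (ℚ._< e ℚ.* (e ℚ.* ε₂))
       (cong ℚ.∣_∣ (difference (s m) (s n) rm rn
         (recip-inverse δ 0<δ (s m) δ≤sm) (recip-inverse δ 0<δ (s n) δ≤sn)))
       (∣*∣-bound rm (rn ℚ.* (s n ℚ.- s m)) 0<e (recip-bound δ 0<δ (s m) e δe≡1 0<e δ≤sm)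
         (∣*∣-bound rn (s n ℚ.- s m) 0<e (recip-bound δ 0<δ (s n) e δe≡1 0<e δ≤sn)
           (close n m (m⊔n≤o⇒n≤o N M ≤n) (m⊔n≤o⇒n≤o N M ≤m))))
  where
  difference : ∀ p q u v → u ℚ.* p ≡ 1ℚ → v ℚ.* q ≡ 1ℚ →
               u ℚ.* (v ℚ.* (q ℚ.- p)) ≡ u ℚ.- v
  difference p q u v up≡1 vq≡1 =
    trans (expand p q u v)
          (cong₂ ℚ._-_ (trans (cong (u ℚ.*_) vq≡1) (ℚₚ.*-identityʳ u))
                       (trans (cong (v ℚ.*_) up≡1) (ℚₚ.*-identityʳ v)))
    where
    expand : ∀ p q u v → u ℚ.* (v ℚ.* (q ℚ.- p)) ≡ u ℚ.* (v ℚ.* q) ℚ.- v ℚ.* (u ℚ.* p)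
    expand = solve 4 (λ p q u v →
      u :* (v :* (q :- p)) := u :* (v :* q) :- v :* (u :* p)) refl
      where open +-*-Solver

record Interpolation (x y z : ℝ) : Set where
  field
    α β   : ℝ
    0≤α   : 0ℝ ≤ℝ α
    0≤β   : 0ℝ ≤ℝ β
    α+β≃1 : α +ℝ β ≃ℝ 1ℝ
    value : α *ℝ x +ℝ β *ℝ y ≃ℝ z

-- The usual weights (y - z)/(y - x) and (z - x)/(y - x) exist only when x < y. Otherwise x, y and z
-- coincide and all weight goes to x, so the case distinction must be supplied.
interpolate : ∀ x y z → Dec (x <ℝ y) → x ≤ℝ z → z ≤ℝ y → Interpolation x y z
interpolate x y z (no x≮y) x≤z z≤y = record
  { α     = 1ℝ
  ; β     = 0ℝ
  ; 0≤α   = pointwise⇒≤ 0ℝ 1ℝ (λ _ → ℚₚ.<⇒≤ 0ℚ<1ℚ)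
  ; 0≤β   = ≤ℝ-refl 0ℝ
  ; α+β≃1 = pointwise⇒≃ (1ℝ +ℝ 0ℝ) 1ℝ (λ _ → refl)
  ; value = ≃-trans (1ℝ *ℝ x +ℝ 0ℝ *ℝ y) x z
      (pointwise⇒≃ (1ℝ *ℝ x +ℝ 0ℝ *ℝ y) x (λ n → trivial (seq x n) (seq y n)))
      (≤ℝ-antisym x z x≤z (≤ℝ-trans z y x z≤y (≮ℝ⇒≥ℝ x y x≮y)))
  }
  where
  trivial : ∀ a b → 1ℚ ℚ.* a ℚ.+ 0ℚ ℚ.* b ≡ a
  trivial = solve 2 (λ a b → con 1ℚ :* a :+ con 0ℚ :* b := a) refl
    where open +-*-Solver
interpolate x y z (yes (δ , 0<δ , N , gap)) x≤z z≤y = record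
  { α     = (y -ℝ z) *ℝ r
  ; β     = (z -ℝ x) *ℝ r
  ; 0≤α   = 0≤* (y -ℝ z) r (0≤- z y z≤y) 0≤r
  ; 0≤β   = 0≤* (z -ℝ x) r (0≤- x z x≤z) 0≤r
  -- Only from index `N` on is `r` a true reciprocal; earlier entries may be the default 0.
  ; α+β≃1 = eventually-≡⇒≃ ((y -ℝ z) *ℝ r +ℝ (z -ℝ x) *ℝ r) 1ℝ N λ n N≤n →
      trans (total (seq x n) (seq y n) (seq z n) (seq r n))
            (recip-inverse δ 0<δ (seq y n ℚ.- seq x n) (gap n N≤n))
  ; value = eventually-≡⇒≃ ((y -ℝ z) *ℝ r *ℝ x +ℝ (z -ℝ x) *ℝ r *ℝ y) z N λ n N≤n →
      trans (combine (seq x n) (seq y n) (seq z n) (seq r n))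
     (trans (cong (seq z n ℚ.*_) (recip-inverse δ 0<δ (seq y n ℚ.- seq x n) (gap n N≤n)))
            (ℚₚ.*-identityʳ (seq z n)))
  }
  where
  r : ℝ
  r = mkℝ (λ n → recip δ 0<δ (seq y n ℚ.- seq x n))
          (recip-cauchy (seq (y -ℝ x)) (cauchy (y -ℝ x)) δ 0<δ N gap)
  0≤r : 0ℝ ≤ℝ r
  0≤r = pointwise⇒≤ 0ℝ r (λ n → 0≤recip δ 0<δ (seq y n ℚ.- seq x n))
  total : ∀ x y z r → (y ℚ.- z) ℚ.* r ℚ.+ (z ℚ.- x) ℚ.* r ≡ r ℚ.* (y ℚ.- x)
  total = solve 4 (λ x y z r → (y :- z) :* r :+ (z :- x) :* r := r :* (y :- x)) refl
    where open +-*-Solver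
  combine : ∀ x y z r → (y ℚ.- z) ℚ.* r ℚ.* x ℚ.+ (z ℚ.- x) ℚ.* r ℚ.* y ≡
                        z ℚ.* (r ℚ.* (y ℚ.- x))
  combine = solve 4 (λ x y z r →
    (y :- z) :* r :* x :+ (z :- x) :* r :* y := z :* (r :* (y :- x))) refl
    where open +-*-Solver

-- Convex hulls

sumℚ : ∀ {n} → (Fin n → ℚ) → ℚ
sumℚ = foldr ℚ._+_ 0ℚ

-- Reduces identities between real sums to identities in ℚ at each index, where the ring solver
-- applies.
seq-sumℝ : ∀ {n} (f : Fin n → ℝ) m → seq (sumℝ f) m ≡ sumℚ (λ i → seq (f i) m)
seq-sumℝ {zero}  f m = refl
seq-sumℝ {suc n} f m = cong (seq (f zero) m ℚ.+_) (seq-sumℝ (f ∘ suc) m)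

sumℚ-cong : ∀ {n} {f g : Fin n → ℚ} → (∀ i → f i ≡ g i) → sumℚ f ≡ sumℚ g
sumℚ-cong {zero}  f≡g = refl
sumℚ-cong {suc n} f≡g = cong₂ ℚ._+_ (f≡g zero) (sumℚ-cong (f≡g ∘ suc))

sumℚ-linear : ∀ {n} (f g : Fin n → ℚ) a b →
  sumℚ (λ i → a ℚ.* f i ℚ.+ b ℚ.* g i) ≡ a ℚ.* sumℚ f ℚ.+ b ℚ.* sumℚ g
sumℚ-linear {zero}  f g a b = zeros a b
  where
  zeros : ∀ a b → 0ℚ ≡ a ℚ.* 0ℚ ℚ.+ b ℚ.* 0ℚ
  zeros = solve 2 (λ a b → con 0ℚ := a :* con 0ℚ :+ b :* con 0ℚ) refl
    where open +-*-Solver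
sumℚ-linear {suc n} f g a b =
  trans (cong (a ℚ.* f zero ℚ.+ b ℚ.* g zero ℚ.+_) (sumℚ-linear (f ∘ suc) (g ∘ suc) a b))
        (rearrange a b (f zero) (g zero) (sumℚ (f ∘ suc)) (sumℚ (g ∘ suc)))
  where
  rearrange : ∀ a b x y s t → (a ℚ.* x ℚ.+ b ℚ.* y) ℚ.+ (a ℚ.* s ℚ.+ b ℚ.* t) ≡
                              a ℚ.* (x ℚ.+ s) ℚ.+ b ℚ.* (y ℚ.+ t)
  rearrange = solve 6 (λ a b x y s t →
    (a :* x :+ b :* y) :+ (a :* s :+ b :* t) := a :* (x :+ s) :+ b :* (y :+ t)) refl
    where open +-*-Solver

seq-sumℝ-linear : ∀ {n} (f g h : Fin n → ℝ) a b m →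
  (∀ i → seq (h i) m ≡ a ℚ.* seq (f i) m ℚ.+ b ℚ.* seq (g i) m) →
  seq (sumℝ h) m ≡ a ℚ.* seq (sumℝ f) m ℚ.+ b ℚ.* seq (sumℝ g) m
seq-sumℝ-linear f g h a b m eq =
  trans (seq-sumℝ h m)
 (trans (sumℚ-cong eq)
 (trans (sumℚ-linear (λ i → seq (f i) m) (λ i → seq (g i) m) a b)
        (sym (cong₂ (λ s t → a ℚ.* s ℚ.+ b ℚ.* t) (seq-sumℝ f m) (seq-sumℝ g m)))))

unitWeight : ∀ {n} → Fin n → Fin n → ℝ
unitWeight zero    zero    = 1ℝ
unitWeight zero    (suc _) = 0ℝ
unitWeight (suc _) zero    = 0ℝ
unitWeight (suc i) (suc j) = unitWeight i j

0≤unitWeight : ∀ {n} (i j : Fin n) → 0ℝ ≤ℝ unitWeight i j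
0≤unitWeight zero    zero    = pointwise⇒≤ 0ℝ 1ℝ (λ _ → ℚₚ.<⇒≤ 0ℚ<1ℚ)
0≤unitWeight zero    (suc _) = ≤ℝ-refl 0ℝ
0≤unitWeight (suc _) zero    = ≤ℝ-refl 0ℝ
0≤unitWeight (suc i) (suc j) = 0≤unitWeight i j

unitWeight-≢ : ∀ {n} (i j : Fin n) → i ≢ j → unitWeight i j ≃ℝ 0ℝ
unitWeight-≢ zero    zero    i≢j = contradiction refl i≢j
unitWeight-≢ zero    (suc _) _   = ≃-refl 0ℝ
unitWeight-≢ (suc _) zero    _   = ≃-refl 0ℝ
unitWeight-≢ (suc i) (suc j) i≢j = unitWeight-≢ i j (i≢j ∘ cong suc)

sumℚ-0 : ∀ n → sumℚ {n} (λ _ → 0ℚ) ≡ 0ℚ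
sumℚ-0 zero    = refl
sumℚ-0 (suc n) = trans (ℚₚ.+-identityˡ (sumℚ {n} (λ _ → 0ℚ))) (sumℚ-0 n)

sumℚ-unitWeight : ∀ {n} i (x : Fin n → ℚ) m → sumℚ (λ j → seq (unitWeight i j) m ℚ.* x j) ≡ x i
sumℚ-unitWeight {suc n} zero x m =
  trans (cong₂ ℚ._+_ (ℚₚ.*-identityˡ (x zero))
          (trans (sumℚ-cong (λ j → ℚₚ.*-zeroˡ (x (suc j)))) (sumℚ-0 n)))
        (ℚₚ.+-identityʳ (x zero))
sumℚ-unitWeight (suc i) x m =
  trans (cong₂ ℚ._+_ (ℚₚ.*-zeroˡ (x zero)) (sumℚ-unitWeight i (x ∘ suc) m))
        (ℚₚ.+-identityˡ (x (suc i)))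

seq-sum-unitWeight-1 : ∀ {n} (i : Fin n) m → seq (sumℝ (unitWeight i)) m ≡ 1ℚ
seq-sum-unitWeight-1 i m =
  trans (seq-sumℝ (unitWeight i) m)
 (trans (sumℚ-cong (λ j → sym (ℚₚ.*-identityʳ (seq (unitWeight i j) m))))
        (sumℚ-unitWeight i (λ _ → 1ℚ) m))

seq-sum-unitWeight : ∀ {n} i (x : Fin n → ℝ) m →
                     seq (sumℝ (λ j → unitWeight i j *ℝ x j)) m ≡ seq (x i) m
seq-sum-unitWeight i x m =
  trans (seq-sumℝ (λ j → unitWeight i j *ℝ x j) m) (sumℚ-unitWeight i (λ j → seq (x j) m) m)

module _ {n} {v : Fin n → Point} {S : Subset n} where

  ∈conv-resp-≈ : ∀ {p q} → p ≈ q → p ∈conv⟨ v , S ⟩ → q ∈conv⟨ v , S ⟩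
  ∈conv-resp-≈ {p} {q} (x≃ , y≃) (w , 0≤w , w≃0 , ∑w≃1 , ∑x≃ , ∑y≃) =
      w , 0≤w , w≃0 , ∑w≃1
    , ≃-trans (sumℝ (λ i → w i *ℝ proj₁ (v i))) (proj₁ p) (proj₁ q) ∑x≃ x≃
    , ≃-trans (sumℝ (λ i → w i *ℝ proj₂ (v i))) (proj₂ p) (proj₂ q) ∑y≃ y≃

  vertex-∈conv : ∀ {i} → i ∈ˢ S → v i ∈conv⟨ v , S ⟩
  vertex-∈conv {i} i∈S =
      unitWeight i
    , 0≤unitWeight i
    , (λ j j∉S → unitWeight-≢ i j λ { refl → j∉S i∈S })
    , pointwise⇒≃ (sumℝ (unitWeight i)) 1ℝ (seq-sum-unitWeight-1 i)
    , pointwise⇒≃ (sumℝ (λ j → unitWeight i j *ℝ proj₁ (v j))) (proj₁ (v i))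
        (seq-sum-unitWeight i (proj₁ ∘ v))
    , pointwise⇒≃ (sumℝ (λ j → unitWeight i j *ℝ proj₂ (v j))) (proj₂ (v i))
        (seq-sum-unitWeight i (proj₂ ∘ v))

  -- Mixing the two weight functions with α and β gives weights for the mixed point.
  segment-∈conv : ∀ α β {p q} → 0ℝ ≤ℝ α → 0ℝ ≤ℝ β → α +ℝ β ≃ℝ 1ℝ →
    p ∈conv⟨ v , S ⟩ → q ∈conv⟨ v , S ⟩ →
    (α *ℝ proj₁ p +ℝ β *ℝ proj₁ q , α *ℝ proj₂ p +ℝ β *ℝ proj₂ q) ∈conv⟨ v , S ⟩
  segment-∈conv α β {p} {q} 0≤α 0≤β α+β≃1
    (w , 0≤w , w≃0 , ∑w≃1 , ∑wx≃ , ∑wy≃) (u , 0≤u , u≃0 , ∑u≃1 , ∑ux≃ , ∑uy≃) =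
      t
    , (λ i → 0≤+ (α *ℝ w i) (β *ℝ u i) (0≤* α (w i) 0≤α (0≤w i)) (0≤* β (u i) 0≤β (0≤u i)))
    , (λ i i∉S → ≃-trans (t i) (α *ℝ 0ℝ +ℝ β *ℝ 0ℝ) 0ℝ
        (mix (w i) 0ℝ (u i) 0ℝ (w≃0 i i∉S) (u≃0 i i∉S))
        (pointwise⇒≃ (α *ℝ 0ℝ +ℝ β *ℝ 0ℝ) 0ℝ (λ m → zeros (seq α m) (seq β m))))
    , ≃-trans (sumℝ t) (α *ℝ sumℝ w +ℝ β *ℝ sumℝ u) 1ℝ
        (pointwise⇒≃ (sumℝ t) (α *ℝ sumℝ w +ℝ β *ℝ sumℝ u)
          (λ m → seq-sumℝ-linear w u t (seq α m) (seq β m) m (λ _ → refl)))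
        (≃-trans (α *ℝ sumℝ w +ℝ β *ℝ sumℝ u) (α *ℝ 1ℝ +ℝ β *ℝ 1ℝ) 1ℝ
          (mix (sumℝ w) 1ℝ (sumℝ u) 1ℝ ∑w≃1 ∑u≃1)
          (≃-trans (α *ℝ 1ℝ +ℝ β *ℝ 1ℝ) (α +ℝ β) 1ℝ
            (pointwise⇒≃ (α *ℝ 1ℝ +ℝ β *ℝ 1ℝ) (α +ℝ β)
              (λ m → cong₂ ℚ._+_ (ℚₚ.*-identityʳ (seq α m)) (ℚₚ.*-identityʳ (seq β m))))
            α+β≃1))
    , coordinate (proj₁ ∘ v) (proj₁ p) (proj₁ q) ∑wx≃ ∑ux≃
    , coordinate (proj₂ ∘ v) (proj₂ p) (proj₂ q) ∑wy≃ ∑uy≃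
    where
    t : Fin n → ℝ
    t i = α *ℝ w i +ℝ β *ℝ u i
    mix : ∀ x x′ y y′ → x ≃ℝ x′ → y ≃ℝ y′ → α *ℝ x +ℝ β *ℝ y ≃ℝ α *ℝ x′ +ℝ β *ℝ y′
    mix x x′ y y′ x≃x′ y≃y′ = +ℝ-cong (α *ℝ x) (α *ℝ x′) (β *ℝ y) (β *ℝ y′)
      (*ℝ-congˡ α x x′ x≃x′) (*ℝ-congˡ β y y′ y≃y′)
    zeros : ∀ a b → a ℚ.* 0ℚ ℚ.+ b ℚ.* 0ℚ ≡ 0ℚ
    zeros = solve 2 (λ a b → a :* con 0ℚ :+ b :* con 0ℚ := con 0ℚ) refl
      where open +-*-Solver
    distrib : ∀ a b w u x → (a ℚ.* w ℚ.+ b ℚ.* u) ℚ.* x ≡ a ℚ.* (w ℚ.* x) ℚ.+ b ℚ.* (u ℚ.* x)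
    distrib = solve 5 (λ a b w u x → (a :* w :+ b :* u) :* x := a :* (w :* x) :+ b :* (u :* x)) refl
      where open +-*-Solver
    coordinate : ∀ (x : Fin n → ℝ) pₓ qₓ →
      sumℝ (λ i → w i *ℝ x i) ≃ℝ pₓ → sumℝ (λ i → u i *ℝ x i) ≃ℝ qₓ →
      sumℝ (λ i → t i *ℝ x i) ≃ℝ α *ℝ pₓ +ℝ β *ℝ qₓ
    coordinate x pₓ qₓ w≃ u≃ = ≃-trans (sumℝ tx) (α *ℝ sumℝ wx +ℝ β *ℝ sumℝ ux) (α *ℝ pₓ +ℝ β *ℝ qₓ)
      (pointwise⇒≃ (sumℝ tx) (α *ℝ sumℝ wx +ℝ β *ℝ sumℝ ux)
        (λ m → seq-sumℝ-linear wx ux tx (seq α m) (seq β m) m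
          (λ i → distrib (seq α m) (seq β m) (seq (w i) m) (seq (u i) m) (seq (x i) m))))
      (mix (sumℝ wx) pₓ (sumℝ ux) qₓ w≃ u≃)
      where
      wx ux tx : Fin n → ℝ
      wx i = w i *ℝ x i
      ux i = u i *ℝ x i
      tx i = t i *ℝ x i

  vertical-∈conv : ∀ {τ η₁ η₂ η} → Interpolation η₁ η₂ η →
    (τ , η₁) ∈conv⟨ v , S ⟩ → (τ , η₂) ∈conv⟨ v , S ⟩ → (τ , η) ∈conv⟨ v , S ⟩
  vertical-∈conv {τ} {η₁} {η₂} {η}
    record { α = α ; β = β ; 0≤α = 0≤α ; 0≤β = 0≤β ; α+β≃1 = α+β≃1 ; value = value } p q =
    ∈conv-resp-≈ {α *ℝ τ +ℝ β *ℝ τ , α *ℝ η₁ +ℝ β *ℝ η₂} {τ , η} (abscissa , value)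
      (segment-∈conv α β {τ , η₁} {τ , η₂} 0≤α 0≤β α+β≃1 p q)
    where
    factor : ∀ a b x → a ℚ.* x ℚ.+ b ℚ.* x ≡ x ℚ.* (a ℚ.+ b)
    factor = solve 3 (λ a b x → a :* x :+ b :* x := x :* (a :+ b)) refl
      where open +-*-Solver
    abscissa : α *ℝ τ +ℝ β *ℝ τ ≃ℝ τ
    abscissa = ≃-trans (α *ℝ τ +ℝ β *ℝ τ) (τ *ℝ (α +ℝ β)) τ
      (pointwise⇒≃ (α *ℝ τ +ℝ β *ℝ τ) (τ *ℝ (α +ℝ β))
        (λ m → factor (seq α m) (seq β m) (seq τ m)))
      (≃-trans (τ *ℝ (α +ℝ β)) (τ *ℝ 1ℝ) τ (*ℝ-congˡ τ (α +ℝ β) 1ℝ α+β≃1)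
        (pointwise⇒≃ (τ *ℝ 1ℝ) τ (λ m → ℚₚ.*-identityʳ (seq τ m))))

-- The height is chosen before `S`: one point of the segment ab serves every triangle with side ab.
-- Twin triangles can therefore share the endpoint of their stretches of the line.
height : ∀ {n} (v : Fin n → Point) a b {τ} → Interpolation (proj₁ (v a)) (proj₁ (v b)) τ →
  Σ ℝ λ η → ∀ S → a ∈ˢ S → b ∈ˢ S → (τ , η) ∈conv⟨ v , S ⟩
height v a b {τ}
  record { α = α ; β = β ; 0≤α = 0≤α ; 0≤β = 0≤β ; α+β≃1 = α+β≃1 ; value = value } = η , meets
  where
  η τ′ : ℝ
  η = α *ℝ proj₂ (v a) +ℝ β *ℝ proj₂ (v b)
  τ′ = α *ℝ proj₁ (v a) +ℝ β *ℝ proj₁ (v b)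
  meets : ∀ S → a ∈ˢ S → b ∈ˢ S → (τ , η) ∈conv⟨ v , S ⟩
  meets S a∈S b∈S = ∈conv-resp-≈ {v = v} {S} {τ′ , η} {τ , η} (value , ≃-refl η)
    (segment-∈conv {v = v} {S} α β {v a} {v b} 0≤α 0≤β α+β≃1
      (vertex-∈conv {v = v} {S} a∈S) (vertex-∈conv {v = v} {S} b∈S))

-- Triangles stabbed by a vertical line

⟦⟧-* : {P Q : Set} (d : Dec P) (e : Dec Q) → ⟦ d ⟧ * ⟦ e ⟧ ≡ ⟦ d ×-dec e ⟧
⟦⟧-* (yes _) (yes _) = refl
⟦⟧-* (yes _) (no  _) = refl
⟦⟧-* (no  _) _       = refl

-- A decision of the strict order is the only classical input; the weak order inherits decidability
-- and totality from it.
≤ℝ-dec : ∀ x y → Dec (y <ℝ x) → Dec (x ≤ℝ y)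
≤ℝ-dec x y (yes y<x) = no (<ℝ-≤ℝ-irrefl y x y<x)
≤ℝ-dec x y (no  y≮x) = yes (≮ℝ⇒≥ℝ y x y≮x)

≤ℝ-total : ∀ x y → Dec (y <ℝ x) → x ≤ℝ y ⊎ y ≤ℝ x
≤ℝ-total x y (yes y<x) = inj₂ (<ℝ⇒≤ℝ y x y<x)
≤ℝ-total x y (no  y≮x) = inj₁ (≮ℝ⇒≥ℝ y x y≮x)

-- Double-negation shift over a finite index set: it makes finitely many instances of excluded
-- middle available at once.
¬¬-Fin : ∀ {n} {P : Fin n → Set} → (∀ i → ¬ ¬ P i) → ¬ ¬ (∀ i → P i)
¬¬-Fin {zero}  ¬¬P ¬∀P = ¬∀P λ ()
¬¬-Fin {suc n} ¬¬P ¬∀P = ¬¬P zero λ p₀ → ¬¬-Fin (¬¬P ∘ suc) λ p → ¬∀P λ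
  { zero → p₀ ; (suc i) → p i }

module _ {A : Set} (_≟_ : DecidableEquality A) where

  multiplicity≤1 : ∀ {xs : List A} → Unique xs → ∀ v → ∑[ x ∈ xs ] ⟦ v ≟ x ⟧ ≤ 1
  multiplicity≤1 []            v = z≤n
  multiplicity≤1 {x ∷ xs} (x∉xs ∷ xs!) v with v ≟ x
  ... | no  _    = multiplicity≤1 xs! v
  ... | yes refl = s≤s (≤-trans (∑-mono-∈ xs absent)
                                (≤-reflexive (trans (∑-const xs 0) (*-zeroʳ (length xs)))))
    where
    absent : ∀ {y} → y ∈ˡ xs → ⟦ x ≟ y ⟧ ≤ 0
    absent {y} y∈xs with x ≟ y
    ... | yes x≡y = contradiction x≡y (All.lookup x∉xs y∈xs)
    ... | no  _   = z≤n

module _ {n} (xs ys : List (Fin n)) where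

  ∑-×-proj₁ : Unique xs → ∀ v → ∑[ p ∈ cartesianProduct xs ys ] ⟦ v ≟ᶠ proj₁ p ⟧ ≤ length ys
  ∑-×-proj₁ xs! v = begin
    (∑[ p ∈ cartesianProduct xs ys ] ⟦ v ≟ᶠ proj₁ p ⟧)
      ≡⟨ ∑-× xs ys (λ p → ⟦ v ≟ᶠ proj₁ p ⟧) ⟩
    (∑[ x ∈ xs ] ∑[ y ∈ ys ] ⟦ v ≟ᶠ x ⟧)
      ≡⟨ ∑-swap xs ys (λ x y → ⟦ v ≟ᶠ x ⟧) ⟩
    (∑[ y ∈ ys ] ∑[ x ∈ xs ] ⟦ v ≟ᶠ x ⟧)
      ≤⟨ ∑-bound ys (λ _ → multiplicity≤1 _≟ᶠ_ xs! v) ⟩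
    length ys * 1
      ≡⟨ *-identityʳ (length ys) ⟩
    length ys ∎
    where open ≤-Reasoning

  ∑-×-proj₂ : Unique ys → ∀ v → ∑[ p ∈ cartesianProduct xs ys ] ⟦ v ≟ᶠ proj₂ p ⟧ ≤ length xs
  ∑-×-proj₂ ys! v = begin
    (∑[ p ∈ cartesianProduct xs ys ] ⟦ v ≟ᶠ proj₂ p ⟧)
      ≡⟨ ∑-× xs ys (λ p → ⟦ v ≟ᶠ proj₂ p ⟧) ⟩
    (∑[ x ∈ xs ] ∑[ y ∈ ys ] ⟦ v ≟ᶠ y ⟧)
      ≤⟨ ∑-bound xs (λ _ → multiplicity≤1 _≟ᶠ_ ys! v) ⟩
    length xs * 1
      ≡⟨ *-identityʳ (length xs) ⟩
    length xs ∎
    where open ≤-Reasoning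

triple : ∀ {n} → Fin n → Fin n → Fin n → Subset n
triple a c b = ⁅ a ⁆ ∪ (⁅ c ⁆ ∪ ⁅ b ⁆)

module _ {n} {a c b : Fin n} where

  triple-1 : a ∈ˢ triple a c b
  triple-1 = x∈p∪q⁺ (inj₁ (x∈⁅x⁆ a))

  triple-2 : c ∈ˢ triple a c b
  triple-2 = x∈p∪q⁺ {p = ⁅ a ⁆} (inj₂ (x∈p∪q⁺ (inj₁ (x∈⁅x⁆ c))))

  triple-3 : b ∈ˢ triple a c b
  triple-3 = x∈p∪q⁺ {p = ⁅ a ⁆} (inj₂ (x∈p∪q⁺ {p = ⁅ c ⁆} (inj₂ (x∈⁅x⁆ b))))

  ∈triple⇒∈list : ∀ {v} → v ∈ˢ triple a c b → v ∈ˡ a ∷ c ∷ b ∷ []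
  ∈triple⇒∈list v∈ with x∈p∪q⁻ ⁅ a ⁆ (⁅ c ⁆ ∪ ⁅ b ⁆) v∈
  ... | inj₁ v∈a = here (x∈⁅y⁆⇒x≡y a v∈a)
  ... | inj₂ v∈cb with x∈p∪q⁻ ⁅ c ⁆ ⁅ b ⁆ v∈cb
  ...   | inj₁ v∈c = there (here (x∈⁅y⁆⇒x≡y c v∈c))
  ...   | inj₂ v∈b = there (there (here (x∈⁅y⁆⇒x≡y b v∈b)))

  ∈list⇒∈triple : ∀ {v} → v ∈ˡ a ∷ c ∷ b ∷ [] → v ∈ˢ triple a c b
  ∈list⇒∈triple (here refl)                 = triple-1
  ∈list⇒∈triple (there (here refl))         = triple-2
  ∈list⇒∈triple (there (there (here refl))) = triple-3

module Hypergraph {n} (H : GeometricHypergraph n)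
  (_<?_ : ∀ i j → Dec (proj₁ (point H i) <ℝ proj₁ (point H j))) where

  abscissa : Fin n → ℝ
  abscissa i = proj₁ (point H i)

  infix 4 _⊑_ _⊑?_

  _⊑_ : Fin n → Fin n → Set
  i ⊑ j = abscissa i ≤ℝ abscissa j

  _⊑?_ : ∀ i j → Dec (i ⊑ j)
  i ⊑? j = ≤ℝ-dec (abscissa i) (abscissa j) (j <? i)

  ⊑-trans : ∀ {i j l} → i ⊑ j → j ⊑ l → i ⊑ l
  ⊑-trans {i} {j} {l} = ≤ℝ-trans (abscissa i) (abscissa j) (abscissa l)

  open DecMembership (≡-dec {n = n} Bool._≟_) using () renaming (_∈?_ to _∈ᴱ?_)

  -- When abscissas tie, several orderings of one triangle may qualify. This is harmless: each edge
  -- needs at least one ordering, and the upper bounds count all of them.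
  Edge : Fin n → Fin n → Fin n → Set
  Edge a c b = a ⊑ c × c ⊑ b × triple a c b ∈ˡ edges H

  edge? : ∀ a c b → Dec (Edge a c b)
  edge? a c b = a ⊑? c ×-dec c ⊑? b ×-dec triple a c b ∈ᴱ? edges H

  E : Fin n → Fin n → Fin n → ℕ
  E a c b = ⟦ edge? a c b ⟧

  -- ((c , b) , (a , d)) stands for the two triangles acb and adb on the base ab.
  Quad : Set
  Quad = (Fin n × Fin n) × (Fin n × Fin n)

  Twin : Fin n × Fin n → Fin n × Fin n → Set
  Twin (c , b) (a , d) = Edge a c b × Edge a d b

  twin? : ∀ u w → Dec (Twin u w)
  twin? (c , b) (a , d) = edge? a c b ×-dec edge? a d b

  -- The vertical line through the vertex z meets the segment from i to j at
  -- height h (i , j) whenever i ⊑ z ⊑ j; other values of h are arbitrary.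
  module Stabbing (k : ℕ) (¬crossing : ¬ HasStronglyCrossing k H) (z : Fin n)
    (h : Fin n × Fin n → ℝ)
    (meets : ∀ {i j} → i ⊑ z → z ⊑ j → ∀ S → i ∈ˢ S → j ∈ˢ S →
             (abscissa z , h (i , j)) ∈conv⟨ point H , S ⟩)
    (_<ʰ?_ : ∀ p q → Dec (h p <ℝ h q)) where

    private
      I = Fin n × Fin n

    _≼_ : I → I → Set
    p ≼ q = h p ≤ℝ h q

    _≼?_ : ∀ p q → Dec (p ≼ q)
    p ≼? q = ≤ℝ-dec (h p) (h q) (q <ʰ? p)

    ≼-total : ∀ p q → p ≼ q ⊎ q ≼ p
    ≼-total p q = ≤ℝ-total (h p) (h q) (q <ʰ? p)

    open Selection _≼_ _≼?_ ≼-total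

    between-∈conv : ∀ {S p v q} → Between p v q →
      (abscissa z , h p) ∈conv⟨ point H , S ⟩ → (abscissa z , h q) ∈conv⟨ point H , S ⟩ →
      (abscissa z , h v) ∈conv⟨ point H , S ⟩
    between-∈conv {S} {p} {v} {q} (inj₁ (p≼v , v≼q)) p∈ q∈ =
      vertical-∈conv {v = point H} {S} {abscissa z} {h p} {h q} {h v}
        (interpolate (h p) (h q) (h v) (p <ʰ? q) p≼v v≼q) p∈ q∈
    between-∈conv {S} {p} {v} {q} (inj₂ (q≼v , v≼p)) p∈ q∈ =
      vertical-∈conv {v = point H} {S} {abscissa z} {h q} {h p} {h v}
        (interpolate (h q) (h p) (h v) (q <ʰ? p) q≼v v≼p) q∈ p∈

    -- The stretches from p to t and from t to q cover the stretch from p to q wherever t lies, even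
    -- outside it.
    between-split : ∀ {p v q} t → Between p v q → ¬ Between p v t → Between t v q
    between-split {v = v} t btw ¬btw with ≼-total v t
    between-split t (inj₁ (p≼v , v≼q)) ¬btw | inj₁ v≼t = contradiction (inj₁ (p≼v , v≼t)) ¬btw
    between-split t (inj₁ (p≼v , v≼q)) ¬btw | inj₂ t≼v = inj₁ (t≼v , v≼q)
    between-split t (inj₂ (q≼v , v≼p)) ¬btw | inj₁ v≼t = inj₂ (q≼v , v≼t)
    between-split t (inj₂ (q≼v , v≼p)) ¬btw | inj₂ t≼v = contradiction (inj₂ (t≼v , v≼p)) ¬btw

    -- On the line, acb spans h (c , b) to h (a , b) and adb spans h (a , b) to
    -- h (a , d), so one of them contains any v between h (c , b) and h (a , d).
    apex : I → Quad → Fin n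
    apex v ((c , b) , (a , d)) with between? (c , b) v (a , b)
    ... | yes _ = c
    ... | no  _ = d

    -- Turns the decision inside `apex` into equations, so that later proofs need not repeat the
    -- case split.
    apex-cases : ∀ v (q@((c , b) , (a , d)) : Quad) →
      (apex v q ≡ c × Between (c , b) v (a , b)) ⊎ (apex v q ≡ d × ¬ Between (c , b) v (a , b))
    apex-cases v ((c , b) , (a , d)) with between? (c , b) v (a , b)
    ... | yes btw = inj₁ (refl , btw)
    ... | no ¬btw = inj₂ (refl , ¬btw)

    vertices : I → Quad → List (Fin n)
    vertices v q@((c , b) , (a , d)) = a ∷ apex v q ∷ b ∷ []

    triangle : I → Quad → Subset n
    triangle v q@((c , b) , (a , d)) = triple a (apex v q) b

    module _ {u w : I} (v : I) (left : proj₁ u ⊑ z) (right : z ⊑ proj₂ w)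
             (twin : Twin u w) where

      private
        c = proj₁ u
        b = proj₂ u
        a = proj₁ w
        d = proj₂ w
        -- From a ⊑ c ⊑ z and z ⊑ d ⊑ b the base ab also reaches across the line, so `h (a , b)` is
        -- a genuine height.
        a⊑z : a ⊑ z
        a⊑z = ⊑-trans {a} {c} {z} (proj₁ (proj₁ twin)) left
        z⊑b : z ⊑ b
        z⊑b = ⊑-trans {z} {d} {b} right (proj₁ (proj₂ (proj₂ twin)))

      triangle∈edges : triangle v (u , w) ∈ˡ edges H
      triangle∈edges with apex-cases v (u , w)
      ... | inj₁ (eq , _) =
        subst (λ x → triple a x b ∈ˡ edges H) (sym eq) (proj₂ (proj₂ (proj₁ twin)))
      ... | inj₂ (eq , _) =
        subst (λ x → triple a x b ∈ˡ edges H) (sym eq) (proj₂ (proj₂ (proj₂ twin)))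

      triangle-stabbed : Between u v w →
        (abscissa z , h v) ∈conv⟨ point H , triangle v (u , w) ⟩
      triangle-stabbed btw = stabbed (apex-cases v (u , w))
        where
        stabbed : ∀ {x} → (x ≡ c × Between u v (a , b)) ⊎ (x ≡ d × ¬ Between u v (a , b)) →
                  (abscissa z , h v) ∈conv⟨ point H , triple a x b ⟩
        stabbed (inj₁ (refl , btw′)) =
          between-∈conv {triple a c b} {u} {v} {a , b} btw′
            (meets {c} {b} left z⊑b (triple a c b) triple-2 triple-3)
            (meets {a} {b} a⊑z z⊑b (triple a c b) triple-1 triple-3)
        stabbed (inj₂ (refl , ¬btw′)) =
          between-∈conv {triple a d b} {a , b} {v} {w} (between-split (a , b) btw ¬btw′)
            (meets {a} {b} a⊑z z⊑b (triple a d b) triple-1 triple-3)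
            (meets {a} {d} a⊑z right (triple a d b) triple-1 triple-2)

    open DecMembership (_≟ᶠ_ {n}) using () renaming (_∈?_ to _∈ⱽ?_)

    module _ (vs ys zs : List (Fin n)) (N s : ℕ)
      (vs! : Unique vs) (ys! : Unique ys) (zs! : Unique zs)
      (∣vs∣≤N : length vs ≤ N) (s≤N : s ≤ N) (∣ys∣≤s : length ys ≤ s) (∣zs∣≤s : length zs ≤ s)
      (ys⊑z : ∀ {c} → c ∈ˡ ys → c ⊑ z) (z⊑zs : ∀ {d} → d ∈ˡ zs → z ⊑ d) where

      us ws : List I
      us = cartesianProduct ys vs
      ws = cartesianProduct vs zs

      ∣us∣≤ : length us ≤ s * N
      ∣us∣≤ = ≤-trans (≤-reflexive (length-× ys vs)) (*-mono-≤ ∣ys∣≤s ∣vs∣≤N)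

      ∣ws∣≤ : length ws ≤ N * s
      ∣ws∣≤ = ≤-trans (≤-reflexive (length-× vs zs)) (*-mono-≤ ∣vs∣≤N ∣zs∣≤s)

      -- Setting one of c, b, a, d equal to a given vertex leaves at most `s * (N * N)` quads,
      -- because c and d have `s` choices, a and b have `N`, and s ≤ N. There are four positions.
      Δ : ℕ
      Δ = 4 * (s * (N * N))

      -- The apex is c or d depending on `v`; allowing both gives a bound independent of that choice
      -- and splits it into a part for (c , b) and a part for (a , d).
      ∈vertices-≤ : ∀ v x q → ⟦ x ∈ⱽ? vertices v q ⟧ ≤
        (⟦ x ≟ᶠ proj₁ (proj₁ q) ⟧ + ⟦ x ≟ᶠ proj₂ (proj₁ q) ⟧) +
        (⟦ x ≟ᶠ proj₁ (proj₂ q) ⟧ + ⟦ x ≟ᶠ proj₂ (proj₂ q) ⟧)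
      ∈vertices-≤ v x q@((c , b) , (a , d)) with x ∈ⱽ? vertices v q
      ... | no _ = z≤n
      ... | yes (here x≡a) =
        ≤-trans (≤-trans (⟦⟧-true (x ≟ᶠ a) x≡a) (m≤m+n _ _)) (m≤n+m _ (⟦ x ≟ᶠ c ⟧ + ⟦ x ≟ᶠ b ⟧))
      ... | yes (there (there (here x≡b))) =
        ≤-trans (≤-trans (⟦⟧-true (x ≟ᶠ b) x≡b) (m≤n+m _ ⟦ x ≟ᶠ c ⟧)) (m≤m+n _ _)
      ... | yes (there (here x≡apex)) with apex-cases v q
      ...   | inj₁ (eq , _) =
        ≤-trans (≤-trans (⟦⟧-true (x ≟ᶠ c) (trans x≡apex eq)) (m≤m+n _ _)) (m≤m+n _ _)
      ...   | inj₂ (eq , _) =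
        ≤-trans (≤-trans (⟦⟧-true (x ≟ᶠ d) (trans x≡apex eq)) (m≤n+m _ ⟦ x ≟ᶠ a ⟧))
                (m≤n+m _ (⟦ x ≟ᶠ c ⟧ + ⟦ x ≟ᶠ b ⟧))

      degree≤Δ : ∀ v x → ∑[ q ∈ cartesianProduct us ws ] ⟦ x ∈ⱽ? vertices v q ⟧ ≤ Δ
      degree≤Δ v x = begin
        (∑[ q ∈ cartesianProduct us ws ] ⟦ x ∈ⱽ? vertices v q ⟧)
          ≤⟨ ∑-mono (cartesianProduct us ws) (∈vertices-≤ v x) ⟩
        (∑[ q ∈ cartesianProduct us ws ] (f (proj₁ q) + f (proj₂ q)))
          ≡⟨ ∑-× us ws (λ q → f (proj₁ q) + f (proj₂ q)) ⟩
        (∑[ u ∈ us ] ∑[ w ∈ ws ] (f u + f w))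
          ≡⟨ ∑-cong us (λ u → trans (∑-distrib-+ ws (λ _ → f u) f) (cong (_+ ∑ ws f) (∑-const ws (f u)))) ⟩
        (∑[ u ∈ us ] (length ws * f u + ∑ ws f))
          ≡⟨ ∑-distrib-+ us (λ u → length ws * f u) (λ _ → ∑ ws f) ⟩
        (∑[ u ∈ us ] length ws * f u) + (∑[ u ∈ us ] ∑ ws f)
          ≡⟨ cong₂ _+_ (sym (*-distribˡ-∑ us (length ws) f)) (∑-const us (∑ ws f)) ⟩
        length ws * ∑ us f + length us * ∑ ws f
          ≤⟨ +-mono-≤ (*-mono-≤ ∣ws∣≤ ∑us≤) (*-mono-≤ ∣us∣≤ ∑ws≤) ⟩
        N * s * (N + N) + s * N * (N + N)
          ≡⟨ collect N s ⟩
        Δ ∎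
        where
        open ≤-Reasoning
        f : I → ℕ
        f p = ⟦ x ≟ᶠ proj₁ p ⟧ + ⟦ x ≟ᶠ proj₂ p ⟧
        collect : ∀ N s → N * s * (N + N) + s * N * (N + N) ≡ 4 * (s * (N * N))
        collect = solve-∀
        ∑us≤ : ∑ us f ≤ N + N
        ∑us≤ = ≤-trans
          (≤-reflexive (∑-distrib-+ us (λ p → ⟦ x ≟ᶠ proj₁ p ⟧) (λ p → ⟦ x ≟ᶠ proj₂ p ⟧)))
          (+-mono-≤ (≤-trans (∑-×-proj₁ ys vs ys! x) ∣vs∣≤N)
                    (≤-trans (∑-×-proj₂ ys vs vs! x) (≤-trans ∣ys∣≤s s≤N)))
        ∑ws≤ : ∑ ws f ≤ N + N
        ∑ws≤ = ≤-trans
          (≤-reflexive (∑-distrib-+ ws (λ p → ⟦ x ≟ᶠ proj₁ p ⟧) (λ p → ⟦ x ≟ᶠ proj₂ p ⟧)))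
          (+-mono-≤ (≤-trans (∑-×-proj₁ vs zs vs! x) (≤-trans ∣zs∣≤s s≤N))
                    (≤-trans (∑-×-proj₂ vs zs zs! x) ∣vs∣≤N))

      -- Each quad counted here selects a triangle through the point of height `h v` on the line.
      -- With 3 vertices per triangle and at most `Δ` quads at each vertex, a larger count would let
      -- `disjointFamily` pick k disjoint triangles through that point.
      depth : ∀ v → (∑[ u ∈ us ] ∑[ w ∈ ws ] ⟦ twin? u w ⟧ * ⟦ between? u v w ⟧) ≤ 3 * Δ * k
      depth v = ≮⇒≥ λ deep → ¬crossing (cross (begin-strict
        3 * Δ * k
          <⟨ deep ⟩
        (∑[ u ∈ us ] ∑[ w ∈ ws ] ⟦ twin? u w ⟧ * ⟦ between? u v w ⟧)
          ≡⟨ ∑-cong us (λ u → ∑-cong ws (λ w → ⟦⟧-* (twin? u w) (between? u v w))) ⟩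
        (∑[ u ∈ us ] ∑[ w ∈ ws ] ⟦ good? (u , w) ⟧)
          ≡⟨ ∑-× us ws (λ q → ⟦ good? q ⟧) ⟨
        (∑[ q ∈ cartesianProduct us ws ] ⟦ good? q ⟧)
          ≡⟨ length-filter-∑ good? (cartesianProduct us ws) ⟨
        length qs ∎))
        where
        open ≤-Reasoning
        Good : Quad → Set
        Good (u , w) = Twin u w × Between u v w
        good? : ∀ q → Dec (Good q)
        good? (u , w) = twin? u w ×-dec between? u v w
        qs : List Quad
        qs = filter good? (cartesianProduct us ws)
        stabbed : ∀ q → q ∈ˡ qs → triangle v q ∈ˡ edges H ×
                  (abscissa z , h v) ∈conv⟨ point H , triangle v q ⟩
        stabbed (u , w) q∈qs =
            triangle∈edges {u} {w} v left right (proj₁ good)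
          , triangle-stabbed {u} {w} v left right (proj₁ good) (proj₂ good)
          where
          q∈      = proj₁ (∈-filter⁻ good? {xs = cartesianProduct us ws} q∈qs)
          good    = proj₂ (∈-filter⁻ good? {xs = cartesianProduct us ws} q∈qs)
          u∈,w∈   = ∈-cartesianProduct⁻ us ws q∈
          left    = ys⊑z (proj₁ (∈-cartesianProduct⁻ ys vs (proj₁ u∈,w∈)))
          right   = z⊑zs (proj₂ (∈-cartesianProduct⁻ vs zs (proj₂ u∈,w∈)))
        cross : 3 * Δ * k < length qs → HasStronglyCrossing k H
        cross big = (λ i → triangle v (f i))
                  , (λ i → proj₁ (stabbed (f i) (f∈qs i)))
                  , (λ { i j i≢j (x , x∈) →
                       let x∈i , x∈j = x∈p∩q⁻ (triangle v (f i)) (triangle v (f j)) x∈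
                       in f-disjoint i j i≢j (∈triple⇒∈list x∈i) (∈triple⇒∈list x∈j) })
                  , (abscissa z , h v) , λ i → proj₂ (stabbed (f i) (f∈qs i))
          where
          family = disjointFamily _≟ᶠ_ (vertices v) 3 (λ _ → ≤-refl) k qs Δ
            (λ x → ≤-trans (∑-filter-≤ good? (cartesianProduct us ws) _) (degree≤Δ v x)) big
          f = proj₁ family
          f∈qs = proj₁ (proj₂ family)
          f-disjoint = proj₂ (proj₂ family)

      -- The squared form of O(s^(3/2) N²). The constant 96 is 8 from `selection`, 3 from the
      -- vertices of a triangle and 4 from `Δ`.
      twins²≤ : (∑[ u ∈ us ] ∑[ w ∈ ws ] ⟦ twin? u w ⟧) * (∑[ u ∈ us ] ∑[ w ∈ ws ] ⟦ twin? u w ⟧) ≤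
                96 * k * (s * s * s * (N * N * N * N))
      twins²≤ = begin
        (∑[ u ∈ us ] ∑[ w ∈ ws ] ⟦ twin? u w ⟧) * (∑[ u ∈ us ] ∑[ w ∈ ws ] ⟦ twin? u w ⟧)
          ≤⟨ selection us ws (λ u w → ⟦ twin? u w ⟧) (λ u w → ⟦⟧≤1 (twin? u w)) (3 * Δ * k) depth ⟩
        length us * (8 * (length ws * (3 * Δ * k)))
          ≤⟨ *-mono-≤ ∣us∣≤ (*-monoʳ-≤ 8 (*-monoˡ-≤ (3 * Δ * k) ∣ws∣≤)) ⟩
        s * N * (8 * (N * s * (3 * Δ * k)))
          ≡⟨ collect N s k ⟩
        96 * k * (s * s * s * (N * N * N * N)) ∎
        where
        open ≤-Reasoning
        collect : ∀ N s k → s * N * (8 * (N * s * (3 * (4 * (s * (N * N))) * k))) ≡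
                            96 * k * (s * s * s * (N * N * N * N))
        collect = solve-∀

-- Auxiliary facts on sorted lists, sums of three terms and sizes of subsets

++-AllPairs-cross : ∀ {A : Set} {R : A → A → Set} ys {zs x z} → AllPairs R (ys ++ zs) →
                    x ∈ˡ ys → z ∈ˡ zs → R x z
++-AllPairs-cross (y ∷ ys) (Ry ∷ _)  (here refl)  z∈zs = All.lookup Ry (∈-++⁺ʳ ys z∈zs)
++-AllPairs-cross (y ∷ ys) (_ ∷ Rys) (there x∈ys) z∈zs = ++-AllPairs-cross ys Rys x∈ys z∈zs

[p+q+r]²≤3[p²+q²+r²] : ∀ p q r → (p + q + r) * (p + q + r) ≤ 3 * (p * p + q * q + r * r)
[p+q+r]²≤3[p²+q²+r²] p q r = begin
  (p + q + r) * (p + q + r)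
    ≡⟨ lhs p q r ⟩
  (p + (q + (r + 0))) * (p + (q + (r + 0)))
    ≤⟨ cauchySchwarz (p ∷ q ∷ r ∷ []) id ⟩
  3 * (p * p + (q * q + (r * r + 0)))
    ≡⟨ rhs p q r ⟩
  3 * (p * p + q * q + r * r) ∎
  where
  open ≤-Reasoning
  lhs : ∀ p q r → (p + q + r) * (p + q + r) ≡ (p + (q + (r + 0))) * (p + (q + (r + 0)))
  lhs = solve-∀
  rhs : ∀ p q r → 3 * (p * p + (q * q + (r * r + 0))) ≡ 3 * (p * p + q * q + r * r)
  rhs = solve-∀

∑-tabulate-∈ : ∀ {n} {A : Set} (f : Fin n → A) (g : A → ℕ) (e : Subset n) →
  (∀ i → g (f i) ≡ ⟦ i ∈ˢ? e ⟧) → ∑ (tabulate f) g ≡ ∣ e ∣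
∑-tabulate-∈ f g []      g≡ = refl
∑-tabulate-∈ f g (b ∷ e) g≡ =
  trans (cong₂ _+_ (g≡ zero) (∑-tabulate-∈ (f ∘ suc) g e (λ i → trans (g≡ (suc i)) (peel i))))
        (count b)
  where
  peel : ∀ i → ⟦ suc i ∈ˢ? b ∷ e ⟧ ≡ ⟦ i ∈ˢ? e ⟧
  peel i = ≤-antisym (⟦⟧-map (suc i ∈ˢ? b ∷ e) (i ∈ˢ? e) drop-there)
                     (⟦⟧-map (i ∈ˢ? e) (suc i ∈ˢ? b ∷ e) thereᵛ)
  count : ∀ b → ⟦ zero ∈ˢ? b ∷ e ⟧ + ∣ e ∣ ≡ ∣ b ∷ e ∣
  count true  = refl
  count false = refl

length-filter-allFin : ∀ {n} (e : Subset n) → length (filter (_∈ˢ? e) (allFin n)) ≡ ∣ e ∣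
length-filter-allFin {n} e = trans (length-filter-∑ (_∈ˢ? e) (allFin n))
  (∑-tabulate-∈ id (λ i → ⟦ i ∈ˢ? e ⟧) e (λ _ → refl))

-- Dyadic subdivision

module Counting {n} (H : GeometricHypergraph n) (k : ℕ) (¬crossing : ¬ HasStronglyCrossing k H)
  (_<?_ : ∀ i j → Dec (proj₁ (point H i) <ℝ proj₁ (point H j))) where

  open Hypergraph H _<?_

  Height : Fin n → Fin n × Fin n → Set
  Height z (i , j) = Σ ℝ λ η → i ⊑ z → z ⊑ j → ∀ S → i ∈ˢ S → j ∈ˢ S →
                     (abscissa z , η) ∈conv⟨ point H , S ⟩

  abstract
    heightAt : ∀ z p → Height z p
    heightAt z (i , j) = go (i ⊑? z) (z ⊑? j)
      where
      go : Dec (i ⊑ z) → Dec (z ⊑ j) → Height z (i , j)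
      -- If the segment does not reach across the line, the default height 0 is never tested, since
      -- the claim about it has a false premise.
      go (no i⋢z) _         = 0ℝ , λ i⊑z _ → contradiction i⊑z i⋢z
      go (yes _)  (no z⋢j)  = 0ℝ , λ _ z⊑j → contradiction z⊑j z⋢j
      go (yes i⊑z) (yes z⊑j) = proj₁ η , λ _ _ → proj₂ η
        where
        η : Σ ℝ λ η → ∀ S → i ∈ˢ S → j ∈ˢ S → (abscissa z , η) ∈conv⟨ point H , S ⟩
        η = height (point H) i j {abscissa z}
              (interpolate (abscissa i) (abscissa j) (abscissa z) (i <? j) i⊑z z⊑j)

  module _ (vs : List (Fin n)) (vs! : Unique vs) (N : ℕ) (∣vs∣≤N : length vs ≤ N) where

    -- T xs a b counts the triangles on the base ab with middle vertex in xs.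
    T : List (Fin n) → Fin n → Fin n → ℕ
    T xs a b = ∑[ c ∈ xs ] E a c b

    -- Counts ordered pairs of triangles on a common base, each triangle also paired with itself.
    P : List (Fin n) → ℕ
    P xs = ∑[ a ∈ vs ] ∑[ b ∈ vs ] T xs a b * T xs a b

    X : List (Fin n) → List (Fin n) → ℕ
    X ys zs = ∑[ a ∈ vs ] ∑[ b ∈ vs ] T ys a b * T zs a b

    -- Regroups the pairs from their base ab to the segments cb and ad that bound the interval on
    -- the line, the form in which selection applies.
    X≡twins : ∀ ys zs → X ys zs ≡
      ∑[ u ∈ cartesianProduct ys vs ] ∑[ w ∈ cartesianProduct vs zs ] ⟦ twin? u w ⟧
    X≡twins ys zs = begin
      (∑[ a ∈ vs ] ∑[ b ∈ vs ] T ys a b * T zs a b)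
        ≡⟨ ∑-swap vs vs (λ a b → T ys a b * T zs a b) ⟩
      (∑[ b ∈ vs ] ∑[ a ∈ vs ] T ys a b * T zs a b)
        ≡⟨ ∑-cong vs (λ b → trans
             (∑-cong vs (λ a → *-∑-∑ ys zs (λ c → E a c b) (λ d → E a d b)))
             (∑-swap vs ys (λ a c → ∑[ d ∈ zs ] E a c b * E a d b))) ⟩
      (∑[ b ∈ vs ] ∑[ c ∈ ys ] ∑[ a ∈ vs ] ∑[ d ∈ zs ] E a c b * E a d b)
        ≡⟨ ∑-swap vs ys (λ b c → ∑[ a ∈ vs ] ∑[ d ∈ zs ] E a c b * E a d b) ⟩
      (∑[ c ∈ ys ] ∑[ b ∈ vs ] ∑[ a ∈ vs ] ∑[ d ∈ zs ] E a c b * E a d b)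
        ≡⟨ ∑-cong ys (λ c → ∑-cong vs (λ b → trans
             (∑-cong vs (λ a → ∑-cong zs (λ d → ⟦⟧-* (edge? a c b) (edge? a d b))))
             (sym (∑-× vs zs (λ w → ⟦ twin? (c , b) w ⟧))))) ⟩
      (∑[ c ∈ ys ] ∑[ b ∈ vs ] ∑[ w ∈ cartesianProduct vs zs ] ⟦ twin? (c , b) w ⟧)
        ≡⟨ ∑-× ys vs (λ u → ∑[ w ∈ cartesianProduct vs zs ] ⟦ twin? u w ⟧) ⟨
      (∑[ u ∈ cartesianProduct ys vs ] ∑[ w ∈ cartesianProduct vs zs ] ⟦ twin? u w ⟧) ∎
      where open ≡-Reasoning

    X² : ∀ z ys zs s → Unique ys → Unique zs → s ≤ N → length ys ≤ s → length zs ≤ s →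
      (∀ {c} → c ∈ˡ ys → c ⊑ z) → (∀ {d} → d ∈ˡ zs → z ⊑ d) →
      X ys zs * X ys zs ≤ 96 * k * (s * s * s * (N * N * N * N))
    X² z ys zs s ys! zs! s≤N ∣ys∣≤s ∣zs∣≤s ys⊑z z⊑zs =
      decidable-stable (_ ≤? _) λ ¬bound →
        -- A height belongs to a segment, so comparing two heights takes four vertices. The
        -- comparisons depend on `z` and are assumed anew for each line.
        ¬¬-Fin (λ i → ¬¬-Fin λ j → ¬¬-Fin λ i′ → ¬¬-Fin λ j′ → ¬¬-excluded-middle) λ cmp →
          ¬bound (subst (λ x → x * x ≤ 96 * k * (s * s * s * (N * N * N * N)))
            (sym (X≡twins ys zs))
            (Stabbing.twins²≤ k ¬crossing z (λ p → proj₁ (heightAt z p))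
              (λ {i} {j} → proj₂ (heightAt z (i , j)))
              (λ p q → cmp (proj₁ p) (proj₂ p) (proj₁ q) (proj₂ q))
              vs ys zs N s vs! ys! zs! ∣vs∣≤N s≤N ∣ys∣≤s ∣zs∣≤s ys⊑z z⊑zs))

    P-++ : ∀ ys zs → P (ys ++ zs) ≡ P ys + P zs + 2 * X ys zs
    P-++ ys zs = begin
      (∑[ a ∈ vs ] ∑[ b ∈ vs ] T (ys ++ zs) a b * T (ys ++ zs) a b)
        ≡⟨ ∑-cong vs (λ a → trans (∑-cong vs (λ b → square a b)) (split vs (λ b → T ys a b * T ys a b)
             (λ b → T zs a b * T zs a b) (λ b → T ys a b * T zs a b))) ⟩
      (∑[ a ∈ vs ] ((∑[ b ∈ vs ] T ys a b * T ys a b) + (∑[ b ∈ vs ] T zs a b * T zs a b) +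
                    2 * (∑[ b ∈ vs ] T ys a b * T zs a b)))
        ≡⟨ split vs (λ a → ∑[ b ∈ vs ] T ys a b * T ys a b) (λ a → ∑[ b ∈ vs ] T zs a b * T zs a b)
             (λ a → ∑[ b ∈ vs ] T ys a b * T zs a b) ⟩
      P ys + P zs + 2 * X ys zs ∎
      where
      open ≡-Reasoning
      expand : ∀ y z → (y + z) * (y + z) ≡ y * y + z * z + 2 * (y * z)
      expand = solve-∀
      square : ∀ a b → T (ys ++ zs) a b * T (ys ++ zs) a b ≡
               T ys a b * T ys a b + T zs a b * T zs a b + 2 * (T ys a b * T zs a b)
      square a b = trans (cong (λ t → t * t) (∑-++ ys zs (λ c → E a c b)))
                         (expand (T ys a b) (T zs a b))
      split : ∀ {A : Set} (xs : List A) (f g h : A → ℕ) →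
              ∑[ x ∈ xs ] (f x + g x + 2 * h x) ≡ ∑ xs f + ∑ xs g + 2 * ∑ xs h
      split xs f g h =
        trans (∑-distrib-+ xs (λ x → f x + g x) (λ x → 2 * h x))
              (cong₂ _+_ (∑-distrib-+ xs f g) (sym (*-distribˡ-∑ xs 2 h)))

    module _ (1≤k : 1 ≤ k) where

      -- Pairs within a half are bounded by induction, pairs across by `X²`. The constant solves 3
      -- (2 c + 4 * 96) = 8 c, with 3 from squaring three terms, 4 from squaring `2 * X` and 8 from
      -- doubling s in s³. As 3 * 2 < 8, the levels sum geometrically and no logarithm appears.
      P² : ∀ i xs → AllPairs _⊑_ xs → Unique xs → length xs ≤ 2 ^ i → 2 ^ i ≤ N →
        P xs * P xs ≤ 576 * k * (2 ^ i * 2 ^ i * 2 ^ i * (N * N * N * N))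
      P² zero xs _ _ ∣xs∣≤1 _ = begin
        P xs * P xs                                 ≤⟨ *-mono-≤ P≤N² P≤N² ⟩
        N * N * (N * N)                             ≡⟨ collect N ⟩
        1 * (1 * 1 * 1 * (N * N * N * N))           ≤⟨ *-monoˡ-≤ (1 * 1 * 1 * (N * N * N * N))
                                                         (*-mono-≤ {1} {576} (s≤s z≤n) 1≤k) ⟩
        576 * k * (1 * 1 * 1 * (N * N * N * N))     ∎
        where
        open ≤-Reasoning
        collect : ∀ N → N * N * (N * N) ≡ 1 * (1 * 1 * 1 * (N * N * N * N))
        collect = solve-∀
        T≤1 : ∀ a b → T xs a b ≤ 1
        T≤1 a b = ≤-trans (∑-bound xs (λ c → ⟦⟧≤1 (edge? a c b))) (*-monoˡ-≤ 1 ∣xs∣≤1)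
        P≤N² : P xs ≤ N * N
        P≤N² = ≤-trans
          (∑-bound vs (λ a → ≤-trans (∑-bound vs (λ b → *-mono-≤ (T≤1 a b) (T≤1 a b)))
                                     (≤-trans (≤-reflexive (*-identityʳ (length vs))) ∣vs∣≤N)))
          (*-monoˡ-≤ N ∣vs∣≤N)
      P² (suc i) xs xs↗ xs! ∣xs∣≤2s 2s≤N = begin
        P xs * P xs
          ≡⟨ cong (λ l → P l * P l) (take++drop≡id s xs) ⟨
        P (ys ++ zs) * P (ys ++ zs)
          ≡⟨ cong (λ p → p * p) (P-++ ys zs) ⟩
        (P ys + P zs + 2 * X ys zs) * (P ys + P zs + 2 * X ys zs)
          ≤⟨ [p+q+r]²≤3[p²+q²+r²] (P ys) (P zs) (2 * X ys zs) ⟩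
        3 * (P ys * P ys + P zs * P zs + 2 * X ys zs * (2 * X ys zs))
          ≡⟨ cong (λ t → 3 * (P ys * P ys + P zs * P zs + t)) (double² (X ys zs)) ⟩
        3 * (P ys * P ys + P zs * P zs + 4 * (X ys zs * X ys zs))
          ≤⟨ *-monoʳ-≤ 3 (+-mono-≤ (+-mono-≤
               (P² i ys (AllPairsₚ.take⁺ s xs↗) (Uniqueₚ.take⁺ s xs!) ∣ys∣≤s s≤N)
               (P² i zs (AllPairsₚ.drop⁺ s xs↗) (Uniqueₚ.drop⁺ s xs!) ∣zs∣≤s s≤N))
               (*-monoʳ-≤ 4 (cross zs refl))) ⟩
        3 * (576 * k * (s * s * s * (N * N * N * N)) + 576 * k * (s * s * s * (N * N * N * N)) +
             4 * (96 * k * (s * s * s * (N * N * N * N))))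
          ≡⟨ collect k s N ⟩
        576 * k * (2 * s * (2 * s) * (2 * s) * (N * N * N * N)) ∎
        where
        open ≤-Reasoning
        s = 2 ^ i
        ys = take s xs
        zs = drop s xs
        s≤N : s ≤ N
        s≤N = ≤-trans (m≤m+n s (s + 0)) 2s≤N
        ∣ys∣≤s : length ys ≤ s
        ∣ys∣≤s = ≤-trans (≤-reflexive (length-take s xs)) (m⊓n≤m s (length xs))
        ∣zs∣≤s : length zs ≤ s
        ∣zs∣≤s = begin
          length zs           ≡⟨ length-drop s xs ⟩
          length xs ∸ s       ≤⟨ ∸-monoˡ-≤ s ∣xs∣≤2s ⟩
          (s + (s + 0)) ∸ s   ≡⟨ m+n∸m≡n s (s + 0) ⟩
          s + 0               ≡⟨ +-identityʳ s ⟩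
          s                   ∎
        double² : ∀ x → 2 * x * (2 * x) ≡ 4 * (x * x)
        double² = solve-∀
        collect : ∀ k s N →
          3 * (576 * k * (s * s * s * (N * N * N * N)) + 576 * k * (s * s * s * (N * N * N * N)) +
               4 * (96 * k * (s * s * s * (N * N * N * N)))) ≡
          576 * k * (2 * s * (2 * s) * (2 * s) * (N * N * N * N))
        collect = solve-∀
        ordered : AllPairs _⊑_ (ys ++ zs)
        ordered = subst (AllPairs _⊑_) (sym (take++drop≡id s xs)) xs↗
        -- The line passes through the first vertex of the right half, which by sortedness lies
        -- weakly between the halves. An empty right half offers no such vertex, but then `X` is 0.
        cross : ∀ zs′ → zs ≡ zs′ → X ys zs * X ys zs ≤ 96 * k * (s * s * s * (N * N * N * N))
        cross [] eq = subst (_≤ 96 * k * (s * s * s * (N * N * N * N)))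
          (sym (cong (λ x → x * x) (trans (cong (X ys) eq) X-[]))) z≤n
          where
          X-[] : X ys [] ≡ 0
          X-[] = trans (∑-cong vs (λ a → trans (∑-cong vs (λ b → *-zeroʳ (T ys a b)))
                                               (trans (∑-const vs 0) (*-zeroʳ (length vs)))))
                       (trans (∑-const vs 0) (*-zeroʳ (length vs)))
        cross (z ∷ zs′) eq = X² z ys zs s (Uniqueₚ.take⁺ s xs!) (Uniqueₚ.drop⁺ s xs!)
          s≤N ∣ys∣≤s ∣zs∣≤s
          (λ c∈ys → ++-AllPairs-cross ys ordered c∈ys (subst (z ∈ˡ_) (sym eq) (here refl)))
          (λ d∈zs → z⊑ (subst (AllPairs _⊑_) eq (AllPairsₚ.drop⁺ s xs↗)) (subst (_ ∈ˡ_) eq d∈zs))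
          where
          z⊑ : AllPairs _⊑_ (z ∷ zs′) → ∀ {d} → d ∈ˡ z ∷ zs′ → z ⊑ d
          z⊑ _        (here refl)   = ≤ℝ-refl (abscissa z)
          z⊑ (z⊑zs′ ∷ _) (there d∈zs′) = All.lookup z⊑zs′ d∈zs′

powerOfTwo : ∀ n → 1 ≤ n → ∃[ i ] (n ≤ 2 ^ i × 2 ^ i ≤ 2 * n)
powerOfTwo (suc zero)    _ = 0 , s≤s z≤n , s≤s z≤n
powerOfTwo (suc (suc n)) _ with powerOfTwo (suc n) (s≤s z≤n)
... | i , 1+n≤2^i , 2^i≤ with m≤n⇒m<n∨m≡n 1+n≤2^i
...   | inj₁ 1+n<2^i = i , 1+n<2^i , ≤-trans 2^i≤ (*-monoʳ-≤ 2 (n≤1+n (suc n)))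
...   | inj₂ 1+n≡2^i = suc i
  , ≤-trans (+-mono-≤ (s≤s z≤n) (m≤m+n (suc n) 0)) (≤-reflexive (cong (2 *_) 1+n≡2^i))
  , ≤-trans (≤-reflexive (cong (2 *_) (sym 1+n≡2^i))) (*-monoʳ-≤ 2 (n≤1+n (suc n)))

-- The number of edges

module EdgeBound {n} (H : GeometricHypergraph n) (k : ℕ) (¬crossing : ¬ HasStronglyCrossing k H)
  (_<?_ : ∀ i j → Dec (proj₁ (point H i) <ℝ proj₁ (point H j))) where

  open Hypergraph H _<?_
  open Counting H k ¬crossing _<?_

  -- Equality means equal abscissas, because distinct vertices may lie on one vertical line.
  ⊑-decTotalOrder : DecTotalOrder 0ℓ 0ℓ 0ℓ
  ⊑-decTotalOrder = record
    { Carrier = Fin n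
    ; _≈_ = λ i j → i ⊑ j × j ⊑ i
    ; _≤_ = _⊑_
    ; isDecTotalOrder = record
      { isTotalOrder = record
        { isPartialOrder = record
          { isPreorder = record
            { isEquivalence = record
              { refl  = λ {i} → ≤ℝ-refl (abscissa i) , ≤ℝ-refl (abscissa i)
              ; sym   = swap
              ; trans = λ {i} {j} {l} (p , q) (r , s) →
                  ⊑-trans {i} {j} {l} p r , ⊑-trans {l} {j} {i} s q
              }
            ; reflexive = proj₁
            ; trans     = λ {i} {j} {l} → ⊑-trans {i} {j} {l}
            }
          ; antisym = _,_
          }
        ; total = λ i j → ≤ℝ-total (abscissa i) (abscissa j) (j <? i)
        }
      ; _≟_  = λ i j → i ⊑? j ×-dec j ⊑? i
      ; _≤?_ = _⊑?_
      }
    }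

  open Sort ⊑-decTotalOrder using (sort; sort-↭; sort-↗)

  vs : List (Fin n)
  vs = sort (allFin n)

  vs↭ : vs ↭ allFin n
  vs↭ = sort-↭ (allFin n)

  vs↗ : AllPairs _⊑_ vs
  vs↗ = Sorted⇒AllPairs (DecTotalOrder.totalOrder ⊑-decTotalOrder) (sort-↗ (allFin n))

  vs! : Unique vs
  vs! = Permutationₛ.Unique-resp-↭ (setoid (Fin n)) (↭⇒↭ₛ (↭-sym vs↭)) (Uniqueₚ.allFin⁺ n)

  ∣vs∣≡n : length vs ≡ n
  ∣vs∣≡n = trans (↭-length vs↭) (length-tabulate id)

  _≟ˢ_ : ∀ (e f : Subset n) → Dec (e ≡ f)
  _≟ˢ_ = ≡-dec Bool._≟_

  -- Filtering the sorted vertex list by membership in `e` leaves its three vertices, already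
  -- ordered by abscissa.
  sortedEdge : ∀ e → e ∈ˡ edges H → ∃[ a ] ∃[ c ] ∃[ b ]
    (Edge a c b × e ≡ triple a c b × a ∈ˡ vs × c ∈ˡ vs × b ∈ˡ vs)
  sortedEdge e e∈edges = go (filter (_∈ˢ? e) vs) refl
    where
    ∣filter∣≡3 : length (filter (_∈ˢ? e) vs) ≡ 3
    ∣filter∣≡3 = trans (↭-length (filter-↭ (_∈ˢ? e) vs↭))
                (trans (length-filter-allFin e) (All.lookup (edges-size H) e∈edges))
    go : ∀ l → filter (_∈ˢ? e) vs ≡ l → ∃[ a ] ∃[ c ] ∃[ b ]
      (Edge a c b × e ≡ triple a c b × a ∈ˡ vs × c ∈ˡ vs × b ∈ˡ vs)
    go []          eq = contradiction (trans (sym (cong length eq)) ∣filter∣≡3) λ ()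
    go (_ ∷ [])    eq = contradiction (trans (sym (cong length eq)) ∣filter∣≡3) λ ()
    go (_ ∷ _ ∷ []) eq = contradiction (trans (sym (cong length eq)) ∣filter∣≡3) λ ()
    go (_ ∷ _ ∷ _ ∷ _ ∷ _) eq = contradiction (trans (sym (cong length eq)) ∣filter∣≡3) λ ()
    go (a ∷ c ∷ b ∷ []) eq =
      a , c , b , edge (subst (AllPairs _⊑_) eq (AllPairsₚ.filter⁺ (_∈ˢ? e) vs↗)) , e≡
        , proj₁ (member (here refl)) , proj₁ (member (there (here refl)))
        , proj₁ (member (there (there (here refl))))
      where
      member : ∀ {v} → v ∈ˡ a ∷ c ∷ b ∷ [] → v ∈ˡ vs × v ∈ˢ e
      member v∈ = ∈-filter⁻ (_∈ˢ? e) {xs = vs} (subst (_ ∈ˡ_) (sym eq) v∈)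
      e≡ : e ≡ triple a c b
      e≡ = ⊆-antisym
        (λ {v} v∈e → ∈list⇒∈triple (subst (v ∈ˡ_) eq
          (∈-filter⁺ (_∈ˢ? e) (∈-resp-↭ (↭-sym vs↭) (∈-allFin v)) v∈e)))
        (λ v∈ → proj₂ (member (∈triple⇒∈list v∈)))
      edge : AllPairs _⊑_ (a ∷ c ∷ b ∷ []) → Edge a c b
      edge ((a⊑c ∷ _) ∷ (c⊑b ∷ _) ∷ _) = a⊑c , c⊑b , subst (_∈ˡ edges H) e≡ e∈edges

  -- Double counting of edges against sorted triples: every edge has a triple, and a triple spans at
  -- most one entry of the duplicate-free edge list.
  ∣E∣≤∑ : ∣E∣ H ≤ ∑[ a ∈ vs ] ∑[ b ∈ vs ] ∑[ c ∈ vs ] E a c b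
  ∣E∣≤∑ = begin
    length (edges H)
      ≡⟨ trans (∑-const (edges H) 1) (*-identityʳ (length (edges H))) ⟨
    (∑[ e ∈ edges H ] 1)
      ≤⟨ ∑-mono-∈ (edges H) counted ⟩
    (∑[ e ∈ edges H ] ∑[ t ∈ ts ] w t * ⟦ s t ≟ˢ e ⟧)
      ≡⟨ ∑-swap (edges H) ts (λ e t → w t * ⟦ s t ≟ˢ e ⟧) ⟩
    (∑[ t ∈ ts ] ∑[ e ∈ edges H ] w t * ⟦ s t ≟ˢ e ⟧)
      ≤⟨ ∑-mono ts (λ t → ≤-trans
           (≤-reflexive (sym (*-distribˡ-∑ (edges H) (w t) (λ e → ⟦ s t ≟ˢ e ⟧))))
           (≤-trans (*-monoʳ-≤ (w t) (multiplicity≤1 _≟ˢ_ (edges-unique H) (s t)))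
                    (≤-reflexive (*-identityʳ (w t))))) ⟩
    ∑ ts w
      ≡⟨ ∑-× vs (cartesianProduct vs vs) w ⟩
    (∑[ a ∈ vs ] ∑[ p ∈ cartesianProduct vs vs ] w (a , p))
      ≡⟨ ∑-cong vs (λ a → ∑-× vs vs (λ p → w (a , p))) ⟩
    (∑[ a ∈ vs ] ∑[ b ∈ vs ] ∑[ c ∈ vs ] E a c b) ∎
    where
    open ≤-Reasoning
    ts : List (Fin n × Fin n × Fin n)
    ts = cartesianProduct vs (cartesianProduct vs vs)
    w : Fin n × Fin n × Fin n → ℕ
    w (a , b , c) = E a c b
    s : Fin n × Fin n × Fin n → Subset n
    s (a , b , c) = triple a c b
    counted : ∀ {e} → e ∈ˡ edges H → 1 ≤ ∑[ t ∈ ts ] w t * ⟦ s t ≟ˢ e ⟧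
    counted {e} e∈ =
      let a , c , b , edge , e≡ , a∈ , c∈ , b∈ = sortedEdge e e∈ in
      ≤-trans (*-mono-≤ (⟦⟧-true (edge? a c b) edge) (⟦⟧-true (triple a c b ≟ˢ e) (sym e≡)))
              (∑-∈ (λ t → w t * ⟦ s t ≟ˢ e ⟧)
                (∈-cartesianProduct⁺ a∈ (∈-cartesianProduct⁺ b∈ c∈)))

  -- Cauchy-Schwarz over a and then over b gives m² ≤ N² p; squaring and inserting p² ≤ 576 k N⁷
  -- gives the exponent 4 + 7.
  ∣E∣⁴≤N¹¹ : 1 ≤ k → ∀ i → n ≤ 2 ^ i →
    let N = 2 ^ i in ∣E∣ H * ∣E∣ H * (∣E∣ H * ∣E∣ H) ≤ 576 * k * N ^ 11
  ∣E∣⁴≤N¹¹ 1≤k i n≤N = begin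
    m * m * (m * m)
      ≤⟨ *-mono-≤ m²≤ m²≤ ⟩
    N * (N * p) * (N * (N * p))
      ≡⟨ regroup N p ⟩
    N * N * N * N * (p * p)
      ≤⟨ *-monoʳ-≤ (N * N * N * N) (P² vs vs! N ∣vs∣≤N 1≤k i vs vs↗ vs! ∣vs∣≤N ≤-refl) ⟩
    N * N * N * N * (576 * k * (N * N * N * (N * N * N * N)))
      ≡⟨ collect k N ⟩
    576 * k * N ^ 11 ∎
    where
    open ≤-Reasoning
    N = 2 ^ i
    m = ∣E∣ H
    ∣vs∣≤N : length vs ≤ N
    ∣vs∣≤N = ≤-trans (≤-reflexive ∣vs∣≡n) n≤N
    t = T vs vs! N ∣vs∣≤N vs
    p = P vs vs! N ∣vs∣≤N vs
    m²≤ : m * m ≤ N * (N * p)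
    m²≤ = begin
      m * m
        ≤⟨ *-mono-≤ ∣E∣≤∑ ∣E∣≤∑ ⟩
      (∑[ a ∈ vs ] ∑[ b ∈ vs ] t a b) * (∑[ a ∈ vs ] ∑[ b ∈ vs ] t a b)
        ≤⟨ cauchySchwarz vs (λ a → ∑[ b ∈ vs ] t a b) ⟩
      length vs * (∑[ a ∈ vs ] (∑[ b ∈ vs ] t a b) * (∑[ b ∈ vs ] t a b))
        ≤⟨ *-mono-≤ ∣vs∣≤N (∑-mono vs (λ a → ≤-trans (cauchySchwarz vs (t a)) (*-monoˡ-≤ _ ∣vs∣≤N))) ⟩
      N * (∑[ a ∈ vs ] N * (∑[ b ∈ vs ] t a b * t a b))
        ≡⟨ cong (N *_) (*-distribˡ-∑ vs N (λ a → ∑[ b ∈ vs ] t a b * t a b)) ⟨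
      N * (N * p) ∎
    regroup : ∀ N p → N * (N * p) * (N * (N * p)) ≡ N * N * N * N * (p * p)
    regroup = solve-∀
    collect : ∀ k N → N * N * N * N * (576 * k * (N * N * N * (N * N * N * N))) ≡
              576 * k * (N * (N * (N * (N * (N * (N * (N * (N * (N * (N * (N * 1)))))))))))
    collect = solve-∀

∣E∣⁴≤ : ∀ {n} (H : GeometricHypergraph n) k → 1 ≤ k → 1 ≤ n →
        ¬ HasStronglyCrossing k H →
        ∣E∣ H ^ 4 ≤ 576 * k * 2 ^ 11 * n ^ 11
∣E∣⁴≤ {n} H k 1≤k 1≤n ¬crossing = let i , n≤N , N≤2n = powerOfTwo n 1≤n in begin
  ∣E∣ H ^ 4
    ≡⟨ fourth (∣E∣ H) ⟩
  ∣E∣ H * ∣E∣ H * (∣E∣ H * ∣E∣ H)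
    ≤⟨ decidable-stable (∣E∣ H * ∣E∣ H * (∣E∣ H * ∣E∣ H) ≤? 576 * k * (2 ^ i) ^ 11) (λ ¬bound →
         ¬¬-Fin (λ i → ¬¬-Fin λ j → ¬¬-excluded-middle) λ cmp →
           ¬bound (EdgeBound.∣E∣⁴≤N¹¹ H k ¬crossing cmp 1≤k i n≤N)) ⟩
  576 * k * (2 ^ i) ^ 11
    -- Rounding n up to a power of two at most doubles it, which costs the factor 2 ^ 11.
    ≤⟨ *-monoʳ-≤ (576 * k) (^-monoˡ-≤ 11 N≤2n) ⟩
  576 * k * (2 * n) ^ 11
    ≡⟨ cong (576 * k *_) (^-distribʳ-* 11 2 n) ⟩
  576 * k * (2 ^ 11 * n ^ 11)
    ≡⟨ *-assoc (576 * k) (2 ^ 11) (n ^ 11) ⟨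
  576 * k * 2 ^ 11 * n ^ 11 ∎
  where
  open ≤-Reasoning
  fourth : ∀ m → m * (m * (m * (m * 1))) ≡ m * m * (m * m)
  fourth = solve-∀

-- Comparison of exponents

^-cancelˡ-≤ : ∀ k {m n} → m ^ suc k ≤ n ^ suc k → m ≤ n
^-cancelˡ-≤ k m^k≤n^k = ≮⇒≥ λ n<m → <⇒≱ (^-monoˡ-< (suc k) n<m) m^k≤n^k

-- The exponent 11 / 4 is at most 3 - 1 / k exactly when k ≥ 4.
weaken-exponent : ∀ k K m n → 4 ≤ k → 1 ≤ n → m ^ 4 ≤ K * n ^ 11 →
                  m ^ k ≤ K ^ k * n ^ (3 * k ∸ 1)
weaken-exponent k K m n@(suc _) 4≤k 1≤n m⁴≤ = ^-cancelˡ-≤ 3 (begin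
  (m ^ k) ^ 4                          ≡⟨ ^-*-assoc m k 4 ⟩
  m ^ (k * 4)                          ≡⟨ cong (m ^_) (*-comm k 4) ⟩
  m ^ (4 * k)                          ≡⟨ ^-*-assoc m 4 k ⟨
  (m ^ 4) ^ k                          ≤⟨ ^-monoˡ-≤ k m⁴≤ ⟩
  (K * n ^ 11) ^ k                     ≡⟨ ^-distribʳ-* k K (n ^ 11) ⟩
  K ^ k * (n ^ 11) ^ k                 ≡⟨ cong (K ^ k *_) (^-*-assoc n 11 k) ⟩
  -- Using `K` where its fourth root would do keeps the constant an integer.
  K ^ k * n ^ (11 * k)                 ≤⟨ *-mono-≤ K^k≤ (^-monoʳ-≤ n exponent) ⟩
  (K ^ k) ^ 4 * n ^ ((3 * k ∸ 1) * 4)  ≡⟨ cong ((K ^ k) ^ 4 *_) (^-*-assoc n (3 * k ∸ 1) 4) ⟨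
  (K ^ k) ^ 4 * (n ^ (3 * k ∸ 1)) ^ 4  ≡⟨ ^-distribʳ-* 4 (K ^ k) (n ^ (3 * k ∸ 1)) ⟨
  (K ^ k * n ^ (3 * k ∸ 1)) ^ 4        ∎)
  where
  open ≤-Reasoning
  K^k≤ : K ^ k ≤ (K ^ k) ^ 4
  K^k≤ = a≤a^1+k 3 (K ^ k)
  split : ∀ k → 11 * k + k ≡ 3 * k * 4
  split = solve-∀
  exponent : 11 * k ≤ (3 * k ∸ 1) * 4
  exponent = begin
    11 * k             ≡⟨ m+n∸n≡m (11 * k) 4 ⟨
    11 * k + 4 ∸ 4     ≤⟨ ∸-monoˡ-≤ 4 (+-monoʳ-≤ (11 * k) 4≤k) ⟩
    11 * k + k ∸ 4     ≡⟨ cong (_∸ 4) (split k) ⟩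
    3 * k * 4 ∸ 4      ≡⟨ *-distribʳ-∸ 4 (3 * k) 1 ⟨
    (3 * k ∸ 1) * 4    ∎

*-/ : ∀ K a j → ℤ.+ (K * a) ℚ./ suc j ≡ (ℤ.+ K ℚ./ 1) ℚ.* (ℤ.+ a ℚ./ suc j)
*-/ K a j = ℚₚ.toℚᵘ-injective (begin-equality
  ℚ.toℚᵘ (ℤ.+ (K * a) ℚ./ suc j)
    ≃⟨ ℚₚ.toℚᵘ-fromℚᵘ (ℚᵘ.mkℚᵘ (ℤ.+ (K * a)) j) ⟩
  ℚᵘ.mkℚᵘ (ℤ.+ (K * a)) j
    ≃⟨ ℚᵘ.*≡* (cong₂ ℤ._*_ (ℤₚ.pos-* K a) (cong ℤ.+_ (+-identityʳ (suc j)))) ⟩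
  ℚᵘ.mkℚᵘ (ℤ.+ K) 0 ℚᵘ.* ℚᵘ.mkℚᵘ (ℤ.+ a) j
    ≃⟨ ℚᵘₚ.*-cong (ℚₚ.toℚᵘ-fromℚᵘ (ℚᵘ.mkℚᵘ (ℤ.+ K) 0)) (ℚₚ.toℚᵘ-fromℚᵘ (ℚᵘ.mkℚᵘ (ℤ.+ a) j)) ⟨
  ℚ.toℚᵘ (ℤ.+ K ℚ./ 1) ℚᵘ.* ℚ.toℚᵘ (ℤ.+ a ℚ./ suc j)
    ≃⟨ ℚₚ.toℚᵘ-homo-* (ℤ.+ K ℚ./ 1) (ℤ.+ a ℚ./ suc j) ⟨
  ℚ.toℚᵘ ((ℤ.+ K ℚ./ 1) ℚ.* (ℤ.+ a ℚ./ suc j)) ∎)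
  where open ℚᵘₚ.≤-Reasoning

-- The integer form of m ≤ K M^(1/(k+1)), scaled by j + 1; raising the floor by one makes the
-- inequality strict, as comparing (k+1)-st powers shows.
floorRoot-bound : ∀ k K m M j → 1 ≤ K → m ^ suc k ≤ K ^ suc k * M →
                  m * suc j < K * suc (floorRoot (suc k) (M * suc j ^ suc k))
floorRoot-bound k K m M j 1≤K m^k≤ = ≰⇒> λ p → <⇒≱ smaller (^-monoˡ-≤ (suc k) p)
  where
  open ≤-Reasoning
  instance
    K^k≢0 : NonZero (K ^ suc k)
    K^k≢0 = m^n≢0 K (suc k) {{>-nonZero 1≤K}}
  J = suc j ^ suc k
  a = floorRoot (suc k) (M * J)
  smaller : (m * suc j) ^ suc k < (K * suc a) ^ suc k
  smaller = begin-strict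
    (m * suc j) ^ suc k              ≡⟨ ^-distribʳ-* (suc k) m (suc j) ⟩
    m ^ suc k * J                    ≤⟨ *-monoˡ-≤ J m^k≤ ⟩
    K ^ suc k * M * J                ≡⟨ *-assoc (K ^ suc k) M J ⟩
    K ^ suc k * (M * J)              <⟨ *-monoʳ-< (K ^ suc k) (floorRoot-upper k (M * J)) ⟩
    K ^ suc k * suc a ^ suc k        ≡⟨ ^-distribʳ-* (suc k) K (suc a) ⟨
    (K * suc a) ^ suc k              ∎

^≤⇒≤root : ∀ k K m M → 1 ≤ K → m ^ suc k ≤ K ^ suc k * M →
           fromℕ m ≤ℝ fromℕ K *ℝ root (suc k) M
^≤⇒≤root k K m M 1≤K m^k≤ ε 0<ε =
  -- Rounding down loses at most 1/(j+1) in the root, and `K` multiplies this loss; hence the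
  -- tolerance is ε / K.
  let δ , 0<δ , Kδ≡ε = quotient K′ ε 0<K′ 0<ε
      J , small      = archimedean δ 0<δ
  in J , λ j J≤j → subst (λ e → ℤ.+ m ℚ./ 1 ℚ.< K′ ℚ.* rootSeq (suc k) M j ℚ.+ e) Kδ≡ε
                         (close δ j (small j J≤j))
  where
  K′ : ℚ
  K′ = ℤ.+ K ℚ./ 1
  0<K′ : 0ℚ ℚ.< K′
  0<K′ = /-mono-< 0 K 0 0 (subst (0 <_) (sym (*-identityʳ K)) 1≤K)
  close : ∀ δ j → ℤ.+ 1 ℚ./ suc j ℚ.< δ → ℤ.+ m ℚ./ 1 ℚ.< K′ ℚ.* rootSeq (suc k) M j ℚ.+ K′ ℚ.* δ
  close δ j 1/j<δ = begin-strict
    ℤ.+ m ℚ./ 1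
      <⟨ /-mono-< m (K * suc a) 0 j
           (subst (m * suc j <_) (sym (*-identityʳ (K * suc a))) (floorRoot-bound k K m M j 1≤K m^k≤)) ⟩
    ℤ.+ (K * suc a) ℚ./ suc j
      ≡⟨ *-/ K (suc a) j ⟩
    K′ ℚ.* (ℤ.+ suc a ℚ./ suc j)
      ≡⟨ cong (K′ ℚ.*_) (/-suc a j) ⟩
    K′ ℚ.* (r ℚ.+ ℤ.+ 1 ℚ./ suc j)
      ≡⟨ ℚₚ.*-distribˡ-+ K′ r (ℤ.+ 1 ℚ./ suc j) ⟩
    K′ ℚ.* r ℚ.+ K′ ℚ.* (ℤ.+ 1 ℚ./ suc j)
      <⟨ ℚₚ.+-monoʳ-< (K′ ℚ.* r) (ℚₚ.*-monoʳ-<-pos K′ {{ℚ.positive 0<K′}} 1/j<δ) ⟩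
    K′ ℚ.* r ℚ.+ K′ ℚ.* δ ∎
    where
    open ℚₚ.≤-Reasoning
    a = floorRoot (suc k) (M * suc j ^ suc k)
    r = rootSeq (suc k) M j

theorem1p3 : ∀ (k : ℕ) → 4 ≤ k →
    Σ ℝ λ C → ∀ (n : ℕ) → 1 ≤ n →
    ∀ (m : ℕ) → IsEx₂SC k n m →
    fromℕ m ≤ℝ C *ℝ (n ^[ (3 * k ∸ 1) / k ])
theorem1p3 k@(suc k-1) 4≤k = fromℕ K , λ { n 1≤n m ((H , ¬crossing , refl) , _) →
  ^≤⇒≤root k-1 K m (n ^ (3 * k ∸ 1)) 1≤K
    (weaken-exponent k K m n 4≤k 1≤n (∣E∣⁴≤ H k (s≤s z≤n) 1≤n ¬crossing)) }
  where
  -- The factor `576 * k` comes from the dyadic recursion, `2 ^ 11` from rounding n up to a power of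
  -- two.
  K = 576 * k * 2 ^ 11
  1≤K : 1 ≤ K
  1≤K = *-mono-≤ {1} {576 * k} {1} {2 ^ 11}
    (*-mono-≤ {1} {576} {1} {k} (s≤s z≤n) (s≤s z≤n)) (m^n>0 2 11)
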